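{- For any assignment of real numbers to the variables $u_\alpha$ ($\alpha$ a Lyndon composition), the linear operator $\Phi$ on $\mathcal{Q}$ defined by $$\Phi(M_\beta)=\sum_{\alpha\in\operatorname{Comp}(n),\,\alpha\le\beta}A_n(\beta,\alpha)\,M_\alpha\qquad\text{for all }n\ge0,\ \beta\in\operatorname{Comp}(n)$$ is an endomorphism of $\mathcal{Q}$ (an element of $\mathrm{End}(\mathcal{Q})$). Moreover, every element of $\mathrm{End}(\mathcal{Q})$ has this form for some such assignment.
   Context: Work over $\mathbb{R}$. Compositions $\alpha=(a_1,\dots,a_k)$ of $n$, $\operatorname{Comp}(n)$, $(n)$; $S_\alpha=\{a_1,\dots,a_1+\dots+a_{k-1}\}$; $\alpha\le\beta$ iff $S_\alpha\subseteq S_\beta$, i.e.\ iff $\beta=\beta_1\cdots\beta_k$ (concatenation) with $a_i=|\beta_i|$ (sum of parts). $M_\alpha=\sum_{i_1<\dots<i_k}x_{i_1}^{a_1}\cdots x_{i_k}^{a_k}$, $M_{()}=1$; $\mathcal{Q}$ the graded Hopf algebra of quasisymmetric functions with coproduct $\Delta(M_\alpha)=\sum_{\alpha=\beta\cdot\gamma}M_\beta\otimes M_\gamma$; $\mathrm{End}(\mathcal{Q})$ = graded Hopf algebra endomorphisms. A composition is Lyndon if, as a word over the positive integers, it is lexicographically strictly smaller than all its nontrivial cyclic rearrangements; $\mathcal{Q}$ is the free polynomial algebra on $\{M_\alpha:\alpha\text{ Lyndon}\}$, so each $M_\beta$ has a unique expression (Lyndon expansion) as a polynomial in these. Let $u_\alpha$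 ($\alpha$ Lyndon) be commuting variables and, for $\beta\in\operatorname{Comp}(n)$, let $A_n(\beta,(n))$ be the polynomial obtained by substituting $u_\alpha$ for $M_\alpha$ in the Lyndon expansion of $M_\beta$. For $\alpha=(a_1,\dots,a_k),\beta\in\operatorname{Comp}(n)$: $A_n(\beta,\alpha)=0$ if $\alpha\not\le\beta$, and otherwise $A_n(\beta,\alpha)=A_{a_1}(\beta_1,(a_1))\cdots A_{a_k}(\beta_k,(a_k))$ where $\beta=\beta_1\cdots\beta_k$ with $|\beta_i|=a_i$; $A_0=(1)$. -}

module Defs where

open import Level using (Level; _⊔_) renaming (suc to lsuc)
open import Algebra.Bundles using (CommutativeRing)
open import Data.Bool using (Bool; true; false; _∧_; if_then_else_; T)
open import Data.Nat using (ℕ; zero; suc; _∸_; _≤ᵇ_; _<ᵇ_; _≡ᵇ_)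
open import Data.List using (List; []; _∷_; _++_; map; concatMap; foldr; length; drop; take; upTo)
open import Data.List.Properties using (≡-dec)
open import Data.Maybe using (Maybe; just; nothing)
open import Data.Product using (Σ; ∃; _×_; _,_; proj₁; proj₂)
open import Data.Sum using (_⊎_)
open import Relation.Nullary using (¬_; does)
open import Relation.Binary.PropositionalEquality using (_≡_)
import Data.Nat as ℕ

-- The real numbers: we quantify over an arbitrary complete ordered
-- field (all of which are isomorphic to ℝ).  Scalars live in its
-- carrier, with setoid equality _≈_.

record RealField (c ℓ : Level) : Set (lsuc (c ⊔ ℓ)) where
  field
    commutativeRing : CommutativeRing c ℓ
  open CommutativeRing commutativeRing public
  field
    0≉1     : ¬ (0# ≈ 1#)
    inverse : ∀ x → ¬ (x ≈ 0#) → Σ Carrier (λ y → x * y ≈ 1#)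
    _<_        : Carrier → Carrier → Set ℓ
    <-resp-≈   : ∀ {x x′ y y′} → x ≈ x′ → y ≈ y′ → x < y → x′ < y′
    <-irrefl   : ∀ {x} → ¬ (x < x)
    <-trans    : ∀ {x y z} → x < y → y < z → x < z
    <-trichot  : ∀ x y → x < y ⊎ (x ≈ y ⊎ y < x)
    +-mono-<   : ∀ {x y} z → x < y → (x + z) < (y + z)
    *-pos      : ∀ {x y} → 0# < x → 0# < y → 0# < (x * y)
    lub : (P : Carrier → Set ℓ) → Σ Carrier P →
          Σ Carrier (λ b → ∀ x → P x → (x < b ⊎ x ≈ b)) →
          Σ Carrier (λ s → (∀ x → P x → (x < s ⊎ x ≈ s)) ×
                           (∀ b → (∀ x → P x → (x < b ⊎ x ≈ b)) → (s < b ⊎ s ≈ b)))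

-- Compositions.  ENCODING: a composition (a₁,…,a_k) is represented by the
-- list (a₁ - 1, …, a_k - 1) of natural numbers; i.e. an entry k ∈ ℕ stands
-- for the positive part suc k.  Every List ℕ is thus a composition.

Comp : Set
Comp = List ℕ

size : Comp → ℕ
size α = foldr ℕ._+_ 0 (map suc α)

-- Comp(n): enumeration of all compositions of n (each exactly once).
-- A composition of n+1 arises uniquely from one of n by prepending a
-- part 1 or by increasing the first part by 1.
comps : ℕ → List Comp
comps zero    = [] ∷ []
comps (suc n) = concatMap step (comps n)
  where
  step : Comp → List Comp
  step []      = (0 ∷ []) ∷ []
  step (a ∷ γ) = (0 ∷ a ∷ γ) ∷ (suc a ∷ γ) ∷ []

-- Lexicographic strict order on words (a proper prefix is smaller).
-- (The encoding a ↦ a - 1 preserves this order.)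
lex< : List ℕ → List ℕ → Bool
lex< []      []      = false
lex< []      (_ ∷ _) = true
lex< (_ ∷ _) []      = false
lex< (x ∷ xs) (y ∷ ys) = if x <ᵇ y then true else (if x ≡ᵇ y then lex< xs ys else false)

allB : {A : Set} → (A → Bool) → List A → Bool
allB p []       = true
allB p (x ∷ xs) = p x ∧ allB p xs

rotate : ℕ → List ℕ → List ℕ
rotate i w = drop i w ++ take i w

isLyndon : Comp → Bool
isLyndon []        = false
isLyndon w@(_ ∷ _) = allB (λ i → lex< w (rotate (suc i) w)) (upTo (length w ∸ 1))

IsLyndon : Comp → Set
IsLyndon α = T (isLyndon α)

LynComp : Set
LynComp = Σ Comp IsLyndon

-- Refinement order: α ≤ β iff β = β₁⋯β_k with |β_i| = a_i.
-- takeExact n β = just (β₁ , rest) if β = β₁ rest with |β₁| = n.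
takeExact : ℕ → Comp → Maybe (Comp × Comp)
takeExact zero    β       = just ([] , β)
takeExact (suc n) []      = nothing
takeExact (suc n) (b ∷ β) with suc b ≤ᵇ suc n
... | false = nothing
... | true  with takeExact (suc n ∸ suc b) β
...   | nothing          = nothing
...   | just (β₁ , rest) = just (b ∷ β₁ , rest)

-- splitBy α β = just (β₁ ∷ … ∷ β_k ∷ []) iff α ≤ β, β = β₁⋯β_k, |β_i| = a_i
splitBy : Comp → Comp → Maybe (List Comp)
splitBy []      []      = just []
splitBy []      (_ ∷ _) = nothing
splitBy (a ∷ α) β with takeExact (suc a) β
... | nothing = nothing
... | just (β₁ , rest) with splitBy α rest
...   | nothing = nothing
...   | just bs = just (β₁ ∷ bs)

-- quasi-shuffles (with multiplicity): M_β M_γ = Σ_{δ ∈ qsh β γ} M_δ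
qsh : Comp → Comp → List Comp
qsh []      γ       = γ ∷ []
qsh (a ∷ β) []      = (a ∷ β) ∷ []
qsh (a ∷ β) (b ∷ γ) =
  map (a ∷_) (qsh β (b ∷ γ)) ++ map (b ∷_) (qsh (a ∷ β) γ)
  ++ map (suc (a ℕ.+ b) ∷_) (qsh β γ)      -- parts a+1 and b+1 merged into a+b+2

-- deconcatenations: Δ M_α = Σ_{(β,γ) ∈ deconc α} M_β ⊗ M_γ
deconc : Comp → List (Comp × Comp)
deconc []      = ([] , []) ∷ []
deconc (a ∷ α) = ([] , a ∷ α) ∷ map (λ p → (a ∷ proj₁ p , proj₂ p)) (deconc α)

_=c_ : Comp → Comp → Bool
α =c β = does (≡-dec ℕ._≟_ α β)

module QSym {c ℓ : Level} (R : RealField c ℓ) where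
  open RealField R

  -- elements of 𝒬: finite formal linear combinations Σ c_i M_{α_i}
  Lin : Set c
  Lin = List (Carrier × Comp)

  -- elements of 𝒬 ⊗ 𝒬: finite combinations Σ c_i M_{β_i} ⊗ M_{γ_i}
  Lin₂ : Set c
  Lin₂ = List (Carrier × Comp × Comp)

  coeff : Lin → Comp → Carrier
  coeff []             δ = 0#
  coeff ((x , β) ∷ xs) δ = (if β =c δ then x else 0#) + coeff xs δ

  coeff₂ : Lin₂ → Comp → Comp → Carrier
  coeff₂ []                  δ ε = 0#
  coeff₂ ((x , β , γ) ∷ xs) δ ε =
    (if β =c δ ∧ γ =c ε then x else 0#) + coeff₂ xs δ ε

  _≃_ : Lin → Lin → Set ℓ
  x ≃ y = ∀ δ → coeff x δ ≈ coeff y δ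

  _≃₂_ : Lin₂ → Lin₂ → Set ℓ
  x ≃₂ y = ∀ δ ε → coeff₂ x δ ε ≈ coeff₂ y δ ε

  basis : Comp → Lin
  basis α = (1# , α) ∷ []

  scale : Carrier → Lin → Lin
  scale x = map (λ t → (x * proj₁ t , proj₂ t))

  one : Lin
  one = basis []

  mul : Lin → Lin → Lin
  mul xs ys = concatMap (λ s → concatMap (λ t →
                map (λ δ → (proj₁ s * proj₁ t , δ)) (qsh (proj₂ s) (proj₂ t))) ys) xs

  Δ : Lin → Lin₂
  Δ = concatMap (λ s → map (λ p → (proj₁ s , proj₁ p , proj₂ p)) (deconc (proj₂ s)))

  counit : Lin → Carrier
  counit x = coeff x []

  -- A linear operator on 𝒬 is given by the images of the basis elements:
  -- img β = Φ(M_β).  Its linear extension: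
  apply : (Comp → Lin) → Lin → Lin
  apply img = concatMap (λ s → scale (proj₁ s) (img (proj₂ s)))

  apply₂ : (Comp → Lin) → Lin₂ → Lin₂
  apply₂ img = concatMap (λ s →
    concatMap (λ t → map (λ t′ → (proj₁ s * proj₁ t * proj₁ t′ , proj₂ t , proj₂ t′))
                         (img (proj₂ (proj₂ s))))
              (img (proj₁ (proj₂ s))))

  record IsHopfEndo (img : Comp → Lin) : Set (c ⊔ ℓ) where
    field
      graded  : ∀ β α → ¬ (size α ≡ size β) → coeff (img β) α ≈ 0#
      unit    : apply img one ≃ one
      mult    : ∀ x y → apply img (mul x y) ≃ mul (apply img x) (apply img y)
      counitˡ : ∀ x → counit (apply img x) ≈ counit x
      comult  : ∀ x → Δ (apply img x) ≃₂ apply₂ img (Δ x)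

  -- polynomials in commuting variables u_α (α Lyndon) with real coefficients,
  -- as finite lists of (coefficient, monomial = list of variables)
  Poly : Set c
  Poly = List (Carrier × List LynComp)

  evalM : Poly → Lin
  evalM = concatMap (λ m → scale (proj₁ m) (foldr (λ v → mul (basis (proj₁ v))) one (proj₂ m)))

  evalU : (LynComp → Carrier) → Poly → Carrier
  evalU u = foldr (λ m r → proj₁ m * foldr (λ v r′ → u v * r′) 1# (proj₂ m) + r) 0#

  -- lyn β is a Lyndon expansion of M_β: a polynomial in the Lyndon M_α
  -- equal to M_β in 𝒬 (unique, since 𝒬 is free on the Lyndon M_α)
  IsLyndonExpansion : (Comp → Poly) → Set ℓ
  IsLyndonExpansion lyn = ∀ β → evalM (lyn β) ≃ basis β

  A : (Comp → Poly) → (LynComp → Carrier) → Comp → Comp → Carrier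
  A lyn u β α with splitBy α β
  ... | nothing = 0#
  ... | just bs = foldr (λ b r → evalU u (lyn b) * r) 1# bs

  -- Φ(M_β) = Σ_{α ∈ Comp(n), α ≤ β} A_n(β,α) M_α   (n = |β|; A = 0 unless α ≤ β)
  Φ : (Comp → Poly) → (LynComp → Carrier) → Comp → Lin
  Φ lyn u β = map (λ α → (A lyn u β α , α)) (comps (size β))

{-# OPTIONS --safe #-}
-- Endomorphisms of 𝒬 correspond to characters ζ : 𝒬 → R. Given ζ, the map
-- M_β ↦ Σ ζ(β₁)⋯ζ(β_k) M_(|β₁|,…,|β_k|), over all cuts of β into nonempty blocks, is multiplicative
-- and comultiplicative because deconcatenation is multiplicative for quasi-shuffles; conversely an
-- endomorphism is recovered, by comultiplicativity, from the character "coefficient of M_(n)", its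
-- composition with evaluation at x₁ = 1, x₂ = x₃ = ⋯ = 0. Characters correspond to values u_α,
-- α Lyndon, because 𝒬 is free on the Lyndon M_α: they generate by hypothesis, and in degree ≤ n
-- there are no more monomials in them than compositions, since the Lyndon words of a monomial,
-- concatenated in weakly decreasing order, can be read off as successive longest Lyndon prefixes.

module Submission where

open import Defs
open import Level using (Level)
open import Algebra.Bundles using (CommutativeRing)
open import Data.Bool using (Bool; true; false; _∧_; if_then_else_; T)
open import Data.Bool.Properties using (T-irrelevant; T-∧)
open import Data.Fin using (Fin; zero; suc)
open import Data.List using (List; []; _∷_; _++_; map; concatMap; foldr; length; drop; take; upTo; deduplicate; filter; lookup; allFin)
open import Data.List.Membership.Propositional using (_∈_; find)
open import Data.List.Membership.Propositional.Properties using (∈-map⁺; ∈-map⁻; ∈-++⁺ˡ; ∈-++⁺ʳ; ∈-++⁻; ∈-concatMap⁺; ∈-concatMap⁻; ∈-deduplicate⁺; ∈-filter⁺; ∈-filter⁻; ∈-upTo⁺; ∈-upTo⁻; ∈-lookup; ∈-allFin)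
open import Data.List.Properties using (≡-dec; length-++; ++-assoc; ++-identityʳ; ∷-injectiveˡ; ∷-injectiveʳ; take++drop≡id; map-++; map-tabulate; filter-notAll)
open import Data.List.Relation.Binary.Lex.Strict using (Lex-<; halt; this; next; <-strictTotalOrder)
open import Data.List.Relation.Binary.Permutation.Propositional as Perm using (_↭_; prep; swap; ↭-refl; ↭-trans; ↭-sym)
open import Data.List.Relation.Binary.Pointwise using (Pointwise-≡⇒≡; ≡⇒Pointwise-≡)
open import Data.List.Relation.Unary.All using (All; []; _∷_)
open import Data.List.Relation.Unary.AllPairs using (AllPairs; []; _∷_)
open import Data.List.Relation.Unary.Any using (here; there)
open import Data.List.Relation.Unary.Unique.Propositional using (Unique)
open import Data.Maybe using (Maybe; just; nothing; maybe′)
open import Data.Nat as ℕ using (ℕ; zero; suc; _∸_)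
open import Data.Nat.ListAction using (sum)
open import Data.Nat.ListAction.Properties using (sum-++; sum-↭)
open import Data.Product using (Σ; ∃; _×_; _,_; proj₁; proj₂; uncurry)
open import Data.Sum using (_⊎_; inj₁; inj₂)
open import Function using (_∘_)
open import Function.Bundles using (Equivalence)
open import Relation.Binary using (tri<; tri≈; tri>; StrictTotalOrder)
open import Relation.Binary.PropositionalEquality as ≡ using (_≡_; _≢_)
open import Relation.Nullary using (¬_; Dec; does; yes; no; contradiction)
open import Relation.Nullary.Decidable using (T?; ¬?; dec-true; dec-false)
open import Relation.Unary using (Pred; Decidable)
import Algebra.Properties.Ring as RingProperties
import Algebra.Solver.Ring.NaturalCoefficients.Default as RingSolver
import Data.List.Relation.Binary.Permutation.Propositional.Properties as ↭
import Data.List.Relation.Unary.All as All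
import Data.List.Relation.Unary.All.Properties as Allₚ
import Data.List.Relation.Unary.AllPairs as AllPairs
import Data.List.Relation.Unary.AllPairs.Properties as AllPairsₚ
import Data.List.Relation.Unary.Any as Any
import Data.List.Relation.Unary.Unique.DecPropositional.Properties as DecUnique
import Data.List.Relation.Unary.Unique.Propositional.Properties as Uniqueₚ
import Data.Nat.Properties as ℕₚ
import Data.Nat.Solver as ℕSolver
import Relation.Binary.Reasoning.Setoid as SetoidReasoning

-- The hypothesis on `lyn` asserts that expansions exist, and `lyn β` may be inhomogeneous: terms of
-- other weights can occur as long as their images cancel. Prescribing values on the Lyndon
-- compositions therefore yields a well-defined character only after algebraic independence is
-- established. The dimension count behind it takes place in bounded degree, whence the truncation
-- of polynomials and the matching cutoff of functionals; the injection of monomials into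
-- compositions that it requires is the uniqueness half of the Chen-Fox-Lyndon theorem. The
-- coefficient of `M_(n)` is a different functional for each n. Evaluation at (1,0,0,...) collects
-- all of them into one multiplicative functional, from which gradedness isolates the right degree
-- again. Multiplicativity of `Φ` rests on the fact that all quasi-shuffles of two blocks have the
-- same size: the letter they produce is the same, so summing over them affects `ζ` alone.

_≟c_ : (α β : Comp) → Dec (α ≡ β)
_≟c_ = ≡-dec ℕ._≟_

=c-refl : ∀ α → (α =c α) ≡ true
=c-refl α with α ≟c α
... | yes _ = ≡.refl
... | no α≢α = contradiction ≡.refl α≢α

=c-≢ : ∀ {α β} → α ≢ β → (α =c β) ≡ false
=c-≢ {α} {β} α≢β with α ≟c β
... | yes α≡β = contradiction α≡β α≢β
... | no _ = ≡.refl

-- Finite sums, and formal sums tested by linear functionals.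

module Sums {c ℓ : Level} (R : CommutativeRing c ℓ) where
  open CommutativeRing R
  open RingSolver commutativeSemiring using (solve; _:=_; _:+_; _:*_)

  ∑ : ∀ {a} {X : Set a} → List X → (X → Carrier) → Carrier
  ∑ []       f = 0#
  ∑ (x ∷ xs) f = f x + ∑ xs f

  module _ {a} {X : Set a} where

    ∑-cong∈ : ∀ (xs : List X) {f g : X → Carrier} → (∀ {x} → x ∈ xs → f x ≈ g x) → ∑ xs f ≈ ∑ xs g
    ∑-cong∈ []       f≈g = refl
    ∑-cong∈ (x ∷ xs) f≈g = +-cong (f≈g (here ≡.refl)) (∑-cong∈ xs (f≈g ∘ there))

    ∑-cong : ∀ (xs : List X) {f g : X → Carrier} → (∀ x → f x ≈ g x) → ∑ xs f ≈ ∑ xs g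
    ∑-cong xs f≈g = ∑-cong∈ xs (λ {x} _ → f≈g x)

    ∑-++ : ∀ (xs ys : List X) {f : X → Carrier} → ∑ (xs ++ ys) f ≈ ∑ xs f + ∑ ys f
    ∑-++ []       ys = sym (+-identityˡ _)
    ∑-++ (x ∷ xs) ys = trans (+-congˡ (∑-++ xs ys)) (sym (+-assoc _ _ _))

    ∑-zero : ∀ (xs : List X) {f : X → Carrier} → (∀ {x} → x ∈ xs → f x ≈ 0#) → ∑ xs f ≈ 0#
    ∑-zero []       f≈0 = refl
    ∑-zero (x ∷ xs) f≈0 = trans (+-cong (f≈0 (here ≡.refl)) (∑-zero xs (f≈0 ∘ there))) (+-identityˡ 0#)

    ∑-+ : ∀ (xs : List X) {f g : X → Carrier} → ∑ xs (λ x → f x + g x) ≈ ∑ xs f + ∑ xs g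
    ∑-+ []       = sym (+-identityˡ 0#)
    ∑-+ (x ∷ xs) = trans (+-congˡ (∑-+ xs))
      (solve 4 (λ p q r s → (p :+ q) :+ (r :+ s) := (p :+ r) :+ (q :+ s)) refl _ _ _ _)

    ∑-*ˡ : ∀ (xs : List X) k {f : X → Carrier} → ∑ xs (λ x → k * f x) ≈ k * ∑ xs f
    ∑-*ˡ []       k = sym (zeroʳ k)
    ∑-*ˡ (x ∷ xs) k = trans (+-congˡ (∑-*ˡ xs k)) (sym (distribˡ k _ _))

    ∑-*ʳ : ∀ (xs : List X) k {f : X → Carrier} → ∑ xs (λ x → f x * k) ≈ ∑ xs f * k
    ∑-*ʳ xs k = trans (∑-cong xs (λ _ → *-comm _ k)) (trans (∑-*ˡ xs k) (*-comm k _))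

    ∑-single : ∀ {xs : List X} {f : X → Carrier} {x} → Unique xs → x ∈ xs →
               (∀ {y} → y ∈ xs → y ≢ x → f y ≈ 0#) → ∑ xs f ≈ f x
    ∑-single {y ∷ xs} (y∉ ∷ u) (here ≡.refl) f≈0 =
      trans (+-congˡ (∑-zero xs (λ z∈ → f≈0 (there z∈) (λ z≡y → All.lookup y∉ z∈ (≡.sym z≡y)))))
            (+-identityʳ _)
    ∑-single {y ∷ xs} (y∉ ∷ u) (there x∈) f≈0 =
      trans (+-cong (f≈0 (here ≡.refl) (All.lookup y∉ x∈)) (∑-single u x∈ (f≈0 ∘ there)))
            (+-identityˡ _)

  module _ {a b} {X : Set a} {Y : Set b} where

    ∑-map : ∀ (h : X → Y) (xs : List X) {f : Y → Carrier} → ∑ (map h xs) f ≈ ∑ xs (f ∘ h)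
    ∑-map h []       = refl
    ∑-map h (x ∷ xs) = +-congˡ (∑-map h xs)

    ∑-concatMap : ∀ (h : X → List Y) (xs : List X) {f : Y → Carrier} →
                  ∑ (concatMap h xs) f ≈ ∑ xs (λ x → ∑ (h x) f)
    ∑-concatMap h []       = refl
    ∑-concatMap h (x ∷ xs) = trans (∑-++ (h x) _) (+-congˡ (∑-concatMap h xs))

    ∑-swap : ∀ (xs : List X) (ys : List Y) {F : X → Y → Carrier} →
             ∑ xs (λ x → ∑ ys (F x)) ≈ ∑ ys (λ y → ∑ xs (λ x → F x y))
    ∑-swap []       ys = sym (∑-zero ys (λ _ → refl))
    ∑-swap (x ∷ xs) ys = trans (+-congˡ (∑-swap xs ys)) (sym (∑-+ ys))

-- A quasisymmetric function x is handled through the linear functionals ⟨ x , f ⟩, f : Comp → R;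
-- products and coproducts then become operations on functions, with no formal sums left.
module Pairing {c ℓ : Level} (R : RealField c ℓ) where
  open RealField R
  open QSym R
  open Sums commutativeRing public
  open SetoidReasoning setoid
  open RingSolver commutativeSemiring using (solve; _:=_; _:+_; _:*_)

  ⟨_,_⟩ : Lin → (Comp → Carrier) → Carrier
  ⟨ x , f ⟩ = ∑ x (λ t → proj₁ t * f (proj₂ t))

  ⟪_,_⟫ : Lin₂ → (Comp → Comp → Carrier) → Carrier
  ⟪ z , F ⟫ = ∑ z (λ t → proj₁ t * F (proj₁ (proj₂ t)) (proj₂ (proj₂ t)))

  -- The functional dual to `M_α`. The order of the test is that of `coeff`, so that the two match
  -- without symmetry of `=c`.
  δ : Comp → Comp → Carrier
  δ α β = if β =c α then 1# else 0#

  δ-refl : ∀ α → δ α α ≡ 1#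
  δ-refl α rewrite =c-refl α = ≡.refl

  δ-≢ : ∀ {α β} → β ≢ α → δ α β ≡ 0#
  δ-≢ β≢α rewrite =c-≢ β≢α = ≡.refl

  pair-cong : ∀ x {f g} → (∀ α → f α ≈ g α) → ⟨ x , f ⟩ ≈ ⟨ x , g ⟩
  pair-cong x f≈g = ∑-cong x (λ t → *-congˡ (f≈g (proj₂ t)))

  pair-+ : ∀ x {f g} → ⟨ x , (λ α → f α + g α) ⟩ ≈ ⟨ x , f ⟩ + ⟨ x , g ⟩
  pair-+ x = trans (∑-cong x (λ _ → distribˡ _ _ _)) (∑-+ x)

  pair-*ˡ : ∀ x k {f} → ⟨ x , (λ α → k * f α) ⟩ ≈ k * ⟨ x , f ⟩
  pair-*ˡ x k = trans (∑-cong x (λ _ → solve 3 (λ p q r → p :* (q :* r) := q :* (p :* r)) refl _ _ _)) (∑-*ˡ x k)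

  pair-*ʳ : ∀ x k {f} → ⟨ x , (λ α → f α * k) ⟩ ≈ ⟨ x , f ⟩ * k
  pair-*ʳ x k = trans (∑-cong x (λ _ → sym (*-assoc _ _ _))) (∑-*ʳ x k)

  pair-zero : ∀ x {f} → (∀ α → f α ≈ 0#) → ⟨ x , f ⟩ ≈ 0#
  pair-zero x f≈0 = ∑-zero x (λ _ → trans (*-congˡ (f≈0 _)) (zeroʳ _))

  pair-∑ : ∀ {a} {X : Set a} x (ys : List X) {F : X → Comp → Carrier} →
           ⟨ x , (λ α → ∑ ys (λ y → F y α)) ⟩ ≈ ∑ ys (λ y → ⟨ x , F y ⟩)
  pair-∑ x ys = trans (∑-cong x (λ t → sym (∑-*ˡ ys (proj₁ t)))) (∑-swap x ys)

  pair-swap : ∀ x y {F : Comp → Comp → Carrier} →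
              ⟨ x , (λ α → ⟨ y , F α ⟩) ⟩ ≈ ⟨ y , (λ β → ⟨ x , (λ α → F α β) ⟩) ⟩
  pair-swap x y = trans (pair-∑ x y) (∑-cong y (λ t → pair-*ˡ x (proj₁ t)))

  pair-basis : ∀ α f → ⟨ basis α , f ⟩ ≈ f α
  pair-basis α f = trans (+-identityʳ _) (*-identityˡ _)

  pair-scale : ∀ k x {f} → ⟨ scale k x , f ⟩ ≈ k * ⟨ x , f ⟩
  pair-scale k x = trans (∑-map _ x) (trans (∑-cong x (λ _ → *-assoc _ _ _)) (∑-*ˡ x k))

  pair-apply : ∀ img x {f} → ⟨ apply img x , f ⟩ ≈ ⟨ x , (λ β → ⟨ img β , f ⟩) ⟩
  pair-apply img x = trans (∑-concatMap _ x) (∑-cong x (λ t → pair-scale (proj₁ t) (img (proj₂ t))))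

  pair-mul : ∀ x y {f} → ⟨ mul x y , f ⟩ ≈ ⟨ x , (λ β → ⟨ y , (λ γ → ∑ (qsh β γ) f) ⟩) ⟩
  pair-mul x y {f} = trans (∑-concatMap _ x) (∑-cong x λ s → begin
    ∑ (concatMap _ y) _
      ≈⟨ ∑-concatMap _ y ⟩
    ∑ y (λ t → ∑ (map _ (qsh (proj₂ s) (proj₂ t))) _)
      ≈⟨ ∑-cong y (λ t → trans (∑-map _ (qsh (proj₂ s) (proj₂ t)))
           (trans (∑-*ˡ (qsh (proj₂ s) (proj₂ t)) (proj₁ s * proj₁ t)) (*-assoc _ _ _))) ⟩
    ∑ y (λ t → proj₁ s * (proj₁ t * ∑ (qsh (proj₂ s) (proj₂ t)) f))
      ≈⟨ ∑-*ˡ y (proj₁ s) ⟩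
    proj₁ s * ⟨ y , (λ γ → ∑ (qsh (proj₂ s) γ) f) ⟩ ∎)

  pair-Δ : ∀ x {F} → ⟪ Δ x , F ⟫ ≈ ⟨ x , (λ α → ∑ (deconc α) (λ p → F (proj₁ p) (proj₂ p))) ⟩
  pair-Δ x = trans (∑-concatMap _ x) (∑-cong x (λ t →
    trans (∑-map _ (deconc (proj₂ t))) (∑-*ˡ (deconc (proj₂ t)) (proj₁ t))))

  pair-apply₂ : ∀ img z {F} → ⟪ apply₂ img z , F ⟫ ≈
                ⟪ z , (λ β γ → ⟨ img β , (λ α → ⟨ img γ , F α ⟩) ⟩) ⟫
  pair-apply₂ img z {F} = trans (∑-concatMap _ z) (∑-cong z λ s →
    let k = proj₁ s ; β = proj₁ (proj₂ s) ; γ = proj₂ (proj₂ s) in begin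
    ∑ (concatMap _ (img β)) _
      ≈⟨ ∑-concatMap _ (img β) ⟩
    ∑ (img β) (λ t → ∑ (map _ (img γ)) _)
      ≈⟨ ∑-cong (img β) (λ t → trans (∑-map _ (img γ)) (∑-cong (img γ) (λ _ → *-assoc _ _ _))) ⟩
    ∑ (img β) (λ t → ∑ (img γ) (λ t′ → (k * proj₁ t) * (proj₁ t′ * F (proj₂ t) (proj₂ t′))))
      ≈⟨ ∑-cong (img β) (λ t → trans (∑-*ˡ (img γ) _) (*-assoc _ _ _)) ⟩
    ∑ (img β) (λ t → k * (proj₁ t * ⟨ img γ , F (proj₂ t) ⟩))
      ≈⟨ ∑-*ˡ (img β) k ⟩
    k * ⟨ img β , (λ α → ⟨ img γ , F α ⟩) ⟩ ∎)

  if-* : ∀ (b : Bool) {x} → (if b then x else 0#) ≈ x * (if b then 1# else 0#)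
  if-* true  = sym (*-identityʳ _)
  if-* false = sym (zeroʳ _)

  if-∧ : ∀ (b b′ : Bool) → (if b ∧ b′ then 1# else 0#) ≈ (if b then 1# else 0#) * (if b′ then 1# else 0#)
  if-∧ true  b′ = sym (*-identityˡ _)
  if-∧ false b′ = sym (zeroˡ _)

  coeff-pair : ∀ x α → coeff x α ≈ ⟨ x , δ α ⟩
  coeff-pair []            α = refl
  coeff-pair ((k , β) ∷ x) α = +-cong (if-* (β =c α)) (coeff-pair x α)

  coeff₂-pair : ∀ z α β → coeff₂ z α β ≈ ⟪ z , (λ γ ε → δ α γ * δ β ε) ⟫
  coeff₂-pair []                α β = refl
  coeff₂-pair ((k , γ , ε) ∷ z) α β =
    +-cong (trans (if-* ((γ =c α) ∧ (ε =c β))) (*-congˡ (if-∧ (γ =c α) (ε =c β)))) (coeff₂-pair z α β)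

  -- A formal sum may repeat a composition. Collecting its terms over a duplicate-free list that
  -- contains the support makes the pairing depend on the coefficients alone, which is how `≃` comes
  -- to imply equality of all functionals.
  pair-expand : ∀ {S} → Unique S → ∀ x → (∀ {t} → t ∈ x → proj₂ t ∈ S) → ∀ f →
                ⟨ x , f ⟩ ≈ ∑ S (λ α → coeff x α * f α)
  pair-expand {S} u x x⊆S f = sym (begin
    ∑ S (λ α → coeff x α * f α)
      ≈⟨ ∑-cong S (λ α → trans (*-congʳ (coeff-pair x α)) (sym (∑-*ʳ x (f α)))) ⟩
    ∑ S (λ α → ∑ x (λ t → proj₁ t * δ α (proj₂ t) * f α))
      ≈⟨ ∑-swap S x ⟩
    ∑ x (λ t → ∑ S (λ α → proj₁ t * δ α (proj₂ t) * f α))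
      ≈⟨ ∑-cong∈ x (λ {t} t∈x → trans
           (∑-single u (x⊆S t∈x) (λ _ y≢ → trans (*-congʳ (trans (*-congˡ (reflexive (δ-≢ (y≢ ∘ ≡.sym)))) (zeroʳ _))) (zeroˡ _)))
           (*-congʳ (trans (*-congˡ (reflexive (δ-refl (proj₂ t)))) (*-identityʳ _)))) ⟩
    ⟨ x , f ⟩ ∎)

  private
    support : Lin → Lin → List Comp
    support x y = deduplicate _≟c_ (map proj₂ (x ++ y))

    support-! : ∀ x y → Unique (support x y)
    support-! x y = DecUnique.deduplicate-! _≟c_ (map proj₂ (x ++ y))

    support-∈ : ∀ x y {t} → t ∈ x ++ y → proj₂ t ∈ support x y
    support-∈ x y t∈ = ∈-deduplicate⁺ _≟c_ (∈-map⁺ proj₂ t∈)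

  -- Meant for homogeneous `x`: functionals that agree in its degree cannot be told apart by it.
  pair-agree : ∀ x {f g} → (∀ α → coeff x α ≈ 0# ⊎ f α ≈ g α) → ⟨ x , f ⟩ ≈ ⟨ x , g ⟩
  pair-agree x {f} {g} agree = begin
    ⟨ x , f ⟩                                     ≈⟨ expand f ⟩
    ∑ (support x []) (λ α → coeff x α * f α)      ≈⟨ ∑-cong (support x []) pointwise ⟩
    ∑ (support x []) (λ α → coeff x α * g α)      ≈⟨ expand g ⟨
    ⟨ x , g ⟩                                     ∎
    where
    expand = pair-expand (support-! x []) x (support-∈ x [] ∘ ∈-++⁺ˡ)
    pointwise : ∀ α → coeff x α * f α ≈ coeff x α * g α
    pointwise α with agree α
    ... | inj₁ z = trans (trans (*-congʳ z) (zeroˡ _)) (sym (trans (*-congʳ z) (zeroˡ _)))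
    ... | inj₂ e = *-congˡ e

  ≃⇒pair : ∀ x y → x ≃ y → ∀ f → ⟨ x , f ⟩ ≈ ⟨ y , f ⟩
  ≃⇒pair x y x≃y f = begin
    ⟨ x , f ⟩                                ≈⟨ pair-expand (support-! x y) x (support-∈ x y ∘ ∈-++⁺ˡ) f ⟩
    ∑ (support x y) (λ α → coeff x α * f α)  ≈⟨ ∑-cong (support x y) (λ α → *-congʳ (x≃y α)) ⟩
    ∑ (support x y) (λ α → coeff y α * f α)  ≈⟨ pair-expand (support-! x y) y (support-∈ x y ∘ ∈-++⁺ʳ x) f ⟨
    ⟨ y , f ⟩                                ∎

  pair⇒≃ : ∀ x y → (∀ f → ⟨ x , f ⟩ ≈ ⟨ y , f ⟩) → x ≃ y
  pair⇒≃ x y x~y α = trans (coeff-pair x α) (trans (x~y (δ α)) (sym (coeff-pair y α)))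

-- The quasi-shuffle bialgebra in dual form.

qsh-size : ∀ β γ {ε} → ε ∈ qsh β γ → size ε ≡ size β ℕ.+ size γ
qsh-size []      γ       (here ≡.refl) = ≡.refl
qsh-size (a ∷ β) []      (here ≡.refl) = ≡.sym (ℕₚ.+-identityʳ _)
qsh-size (a ∷ β) (b ∷ γ) ε∈ with ∈-++⁻ (map (a ∷_) (qsh β (b ∷ γ))) ε∈
... | inj₁ ε∈₁ with ∈-map⁻ (a ∷_) ε∈₁
...   | _ , m , ≡.refl = ≡.trans (≡.cong (suc a ℕ.+_) (qsh-size β (b ∷ γ) m)) (≡.sym (ℕₚ.+-assoc (suc a) _ _))
qsh-size (a ∷ β) (b ∷ γ) ε∈ | inj₂ ε∈′ with ∈-++⁻ (map (b ∷_) (qsh (a ∷ β) γ)) ε∈′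
... | inj₁ ε∈₂ with ∈-map⁻ (b ∷_) ε∈₂
...   | _ , m , ≡.refl = ≡.trans (≡.cong (suc b ℕ.+_) (qsh-size (a ∷ β) γ m))
  (ℕₛ.solve 3 (λ x y z → x ℕₛ.:+ (y ℕₛ.:+ z) ℕₛ.:= y ℕₛ.:+ (x ℕₛ.:+ z)) ≡.refl (suc b) (size (a ∷ β)) (size γ))
  where module ℕₛ = ℕSolver.+-*-Solver
qsh-size (a ∷ β) (b ∷ γ) ε∈ | inj₂ ε∈′ | inj₂ ε∈₃ with ∈-map⁻ (suc (a ℕ.+ b) ∷_) ε∈₃
...   | _ , m , ≡.refl = ≡.trans (≡.cong (suc (suc (a ℕ.+ b)) ℕ.+_) (qsh-size β γ m))
  (ℕₛ.solve 4 (λ x y z w → ℕₛ.con 2 ℕₛ.:+ (x ℕₛ.:+ y) ℕₛ.:+ (z ℕₛ.:+ w) ℕₛ.:= (ℕₛ.con 1 ℕₛ.:+ x ℕₛ.:+ z) ℕₛ.:+ (ℕₛ.con 1 ℕₛ.:+ y ℕₛ.:+ w)) ≡.refl a b (size β) (size γ))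
  where module ℕₛ = ℕSolver.+-*-Solver

deconc-++ : ∀ α {p} → p ∈ deconc α → proj₁ p ++ proj₂ p ≡ α
deconc-++ []      (here ≡.refl) = ≡.refl
deconc-++ (a ∷ α) (here ≡.refl) = ≡.refl
deconc-++ (a ∷ α) (there p∈) with ∈-map⁻ _ p∈
... | q , q∈ , ≡.refl = ≡.cong (a ∷_) (deconc-++ α q∈)

module Bialgebra {c ℓ : Level} (R : RealField c ℓ) where
  open RealField R
  open Sums commutativeRing
  open SetoidReasoning setoid
  open RingSolver commutativeSemiring using (solve; _:=_; _:+_; _:*_)

  -- Transpose of the product: the value at `M_β M_γ` of the linear extension of `f`.
  sh : (Comp → Carrier) → Comp → Comp → Carrier
  sh f β γ = ∑ (qsh β γ) f

  -- Transpose of the coproduct: the value of the bilinear `F` on the coproduct of `M_α`.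
  D : (Comp → Comp → Carrier) → Comp → Carrier
  D F α = ∑ (deconc α) (λ p → F (proj₁ p) (proj₂ p))

  sh-cong : ∀ {f g} β γ → (∀ ε → f ε ≈ g ε) → sh f β γ ≈ sh g β γ
  sh-cong β γ = ∑-cong (qsh β γ)

  sh-+ : ∀ {f g} β γ → sh (λ ε → f ε + g ε) β γ ≈ sh f β γ + sh g β γ
  sh-+ β γ = ∑-+ (qsh β γ)

  sh-[]ˡ : ∀ f γ → sh f [] γ ≈ f γ
  sh-[]ˡ f γ = +-identityʳ _

  sh-[]ʳ : ∀ f β → sh f β [] ≈ f β
  sh-[]ʳ f []      = +-identityʳ _
  sh-[]ʳ f (a ∷ β) = +-identityʳ _

  sh-∷ : ∀ f a β b γ → sh f (a ∷ β) (b ∷ γ) ≈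
         sh (f ∘ (a ∷_)) β (b ∷ γ) + (sh (f ∘ (b ∷_)) (a ∷ β) γ + sh (f ∘ (suc (a ℕ.+ b) ∷_)) β γ)
  sh-∷ f a β b γ = trans (∑-++ (map (a ∷_) (qsh β (b ∷ γ))) _)
    (+-cong (∑-map _ (qsh β (b ∷ γ)))
      (trans (∑-++ (map (b ∷_) (qsh (a ∷ β) γ)) _)
        (+-cong (∑-map _ (qsh (a ∷ β) γ)) (∑-map _ (qsh β γ)))))

  sh-comm : ∀ f β γ → sh f β γ ≈ sh f γ β
  sh-comm f []      γ  = trans (sh-[]ˡ f γ) (sym (sh-[]ʳ f γ))
  sh-comm f (a ∷ β) [] = trans (sh-[]ʳ f (a ∷ β)) (sym (sh-[]ˡ f (a ∷ β)))
  sh-comm f (a ∷ β) (b ∷ γ) = begin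
    sh f (a ∷ β) (b ∷ γ)
      ≈⟨ sh-∷ f a β b γ ⟩
    sh (f ∘ (a ∷_)) β (b ∷ γ) + (sh (f ∘ (b ∷_)) (a ∷ β) γ + sh (f ∘ (suc (a ℕ.+ b) ∷_)) β γ)
      ≈⟨ +-cong (sh-comm _ β (b ∷ γ)) (+-cong (sh-comm _ (a ∷ β) γ) (sh-comm _ β γ)) ⟩
    sh (f ∘ (a ∷_)) (b ∷ γ) β + (sh (f ∘ (b ∷_)) γ (a ∷ β) + sh (f ∘ (suc (a ℕ.+ b) ∷_)) γ β)
      ≈⟨ solve 3 (λ x y z → x :+ (y :+ z) := y :+ (x :+ z)) refl _ _ _ ⟩
    sh (f ∘ (b ∷_)) γ (a ∷ β) + (sh (f ∘ (a ∷_)) (b ∷ γ) β + sh (f ∘ (suc (a ℕ.+ b) ∷_)) γ β)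
      ≡⟨ ≡.cong (λ n → sh (f ∘ (b ∷_)) γ (a ∷ β) + (sh (f ∘ (a ∷_)) (b ∷ γ) β + sh (f ∘ (suc n ∷_)) γ β)) (ℕₚ.+-comm a b) ⟩
    sh (f ∘ (b ∷_)) γ (a ∷ β) + (sh (f ∘ (a ∷_)) (b ∷ γ) β + sh (f ∘ (suc (b ℕ.+ a) ∷_)) γ β)
      ≈⟨ sh-∷ f b γ a β ⟨
    sh f (b ∷ γ) (a ∷ β) ∎

  -- A product of three nonempty words begins with one of the letters a, b, c or with a merger of
  -- two or three of them: seven classes, each an instance for shorter words. Expansion gives nine
  -- terms on either side, since the class of c is spread over three terms on the left and that of a
  -- over three on the right; `sh-∷` gathers these first.
  sh-assoc : ∀ f α β γ → sh (λ ε → sh f ε γ) α β ≈ sh (λ ε → sh f α ε) β γ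
  sh-assoc f [] β γ = trans (+-identityʳ _) (sh-cong β γ (λ ε → sym (sh-[]ˡ f ε)))
  sh-assoc f (a ∷ α) [] γ = trans (+-identityʳ _) (sym (+-identityʳ _))
  sh-assoc f (a ∷ α) (b ∷ β) [] = trans (sh-cong (a ∷ α) (b ∷ β) (sh-[]ʳ f)) (sym (sh-[]ʳ (sh f (a ∷ α)) (b ∷ β)))
  sh-assoc f s@(a ∷ α) t@(b ∷ β) u@(c ∷ γ) = begin
    sh (λ ε → sh f ε u) s t
      ≈⟨ trans (sh-∷ _ a α b β) (+-cong (expandˡ a α t) (+-cong (expandˡ b s β) (expandˡ (suc (a ℕ.+ b)) α β))) ⟩
    (_ + (_ + _)) + ((_ + (_ + _)) + (_ + (_ + _)))
      ≈⟨ solve 9 (λ p q r p′ q′ r′ p″ q″ r″ →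
           (p :+ (q :+ r)) :+ ((p′ :+ (q′ :+ r′)) :+ (p″ :+ (q″ :+ r″)))
           := (q :+ (q′ :+ q″)) :+ (p :+ (p′ :+ (p″ :+ (r :+ (r′ :+ r″))))))
           refl _ _ _ _ _ _ _ _ _ ⟩
    (sh (λ ε → sh f∙c (a ∷ ε) γ) α t + (sh (λ ε → sh f∙c (b ∷ ε) γ) s β + sh (λ ε → sh f∙c (suc (a ℕ.+ b) ∷ ε) γ) α β))
      + (sh (λ ε → sh f∙a ε u) α t + (sh (λ ε → sh f∙b ε u) s β + (sh (λ ε → sh f∙ab ε u) α β
      + (sh (λ ε → sh (f ∘ (suc (a ℕ.+ c) ∷_)) ε γ) α t + (sh (λ ε → sh (f ∘ (suc (b ℕ.+ c) ∷_)) ε γ) s β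
      + sh (λ ε → sh (f ∘ (suc (suc (a ℕ.+ b) ℕ.+ c) ∷_)) ε γ) α β)))))
      ≈⟨ +-cong (trans (sym (sh-∷ (λ ε → sh f∙c ε γ) a α b β)) (sh-assoc f∙c s t γ))
          (+-cong (trans (sh-assoc f∙a α t u) (sh-∷ _ b β c γ)) (+-cong (sh-assoc f∙b s β u) (+-cong (sh-assoc f∙ab α β u)
          (+-cong (sh-assoc _ α t γ) (+-cong (sh-assoc _ s β γ) (trans (sh-assoc _ α β γ) (reflexive abc))))))) ⟩
    sh (sh f∙c s) t γ
      + ((sh (λ ε → sh f∙a α (b ∷ ε)) β u + (sh (λ ε → sh f∙a α (c ∷ ε)) t γ + sh (λ ε → sh f∙a α (suc (b ℕ.+ c) ∷ ε)) β γ))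
      + (sh (sh f∙b s) β u + (sh (sh f∙ab α) β u
      + (sh (sh (f ∘ (suc (a ℕ.+ c) ∷_)) α) t γ + (sh (sh (f ∘ (suc (b ℕ.+ c) ∷_)) s) β γ
      + sh (sh (f ∘ (suc (a ℕ.+ suc (b ℕ.+ c)) ∷_)) α) β γ)))))
      ≈⟨ solve 9 (λ q p p′ p″ q′ r r′ q″ r″ →
           q :+ ((p :+ (p′ :+ p″)) :+ (q′ :+ (r :+ (r′ :+ (q″ :+ r″)))))
           := (p :+ (q′ :+ r)) :+ ((p′ :+ (q :+ r′)) :+ (p″ :+ (q″ :+ r″))))
           refl _ _ _ _ _ _ _ _ _ ⟩
    (_ + (_ + _)) + ((_ + (_ + _)) + (_ + (_ + _)))
      ≈⟨ trans (sh-∷ _ b β c γ) (+-cong (expandʳ b β u) (+-cong (expandʳ c t γ) (expandʳ (suc (b ℕ.+ c)) β γ))) ⟨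
    sh (λ ε → sh f s ε) t u ∎
    where
    f∙a  = f ∘ (a ∷_)
    f∙b  = f ∘ (b ∷_)
    f∙c  = f ∘ (c ∷_)
    f∙ab = f ∘ (suc (a ℕ.+ b) ∷_)

    abc : sh (λ ε → sh (f ∘ (suc (suc (a ℕ.+ b) ℕ.+ c) ∷_)) α ε) β γ ≡ sh (λ ε → sh (f ∘ (suc (a ℕ.+ suc (b ℕ.+ c)) ∷_)) α ε) β γ
    abc = ≡.cong (λ n → sh (λ ε → sh (f ∘ (suc n ∷_)) α ε) β γ)
      (≡.trans (≡.cong suc (ℕₚ.+-assoc a b c)) (≡.sym (ℕₚ.+-suc a (b ℕ.+ c))))

    expandˡ : ∀ x p q → sh (λ ε → sh f (x ∷ ε) u) p q ≈
              sh (λ ε → sh (f ∘ (x ∷_)) ε u) p q + (sh (λ ε → sh f∙c (x ∷ ε) γ) p q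
              + sh (λ ε → sh (f ∘ (suc (x ℕ.+ c) ∷_)) ε γ) p q)
    expandˡ x p q = trans (sh-cong p q (λ ε → sh-∷ f x ε c γ)) (trans (sh-+ p q) (+-congˡ (sh-+ p q)))

    expandʳ : ∀ y p q → sh (λ ε → sh f s (y ∷ ε)) p q ≈
              sh (λ ε → sh f∙a α (y ∷ ε)) p q + (sh (λ ε → sh (f ∘ (y ∷_)) s ε) p q
              + sh (λ ε → sh (f ∘ (suc (a ℕ.+ y) ∷_)) α ε) p q)
    expandʳ y p q = trans (sh-cong p q (λ ε → sh-∷ f a α y ε)) (trans (sh-+ p q) (+-congˡ (sh-+ p q)))

  D-cong∈ : ∀ {F G} α → (∀ x y → x ++ y ≡ α → F x y ≈ G x y) → D F α ≈ D G α
  D-cong∈ α F≈G = ∑-cong∈ (deconc α) (λ p∈ → F≈G _ _ (deconc-++ α p∈))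

  D-cong : ∀ {F G} α → (∀ x y → F x y ≈ G x y) → D F α ≈ D G α
  D-cong α F≈G = D-cong∈ α (λ x y _ → F≈G x y)

  D-+ : ∀ {F G} α → D (λ x y → F x y + G x y) α ≈ D F α + D G α
  D-+ α = ∑-+ (deconc α)

  D-[] : ∀ F → D F [] ≈ F [] []
  D-[] F = +-identityʳ _

  D-∷ : ∀ F a α → D F (a ∷ α) ≈ F [] (a ∷ α) + D (λ x y → F (a ∷ x) y) α
  D-∷ F a α = +-congˡ (∑-map _ (deconc α))

  D-swap : ∀ {F : Comp → Comp → Comp → Comp → Carrier} α β →
           D (λ x y → D (F x y) β) α ≈ D (λ x′ y′ → D (λ x y → F x y x′ y′) α) β
  D-swap α β = ∑-swap (deconc α) (deconc β)

  D-coassoc : ∀ (G : Comp → Comp → Comp → Carrier) α →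
              D (λ x y → D (λ x₁ x₂ → G x₁ x₂ y) x) α ≈ D (λ x y → D (λ y₁ y₂ → G x y₁ y₂) y) α
  D-coassoc G [] = +-congʳ refl
  D-coassoc G (a ∷ α) = begin
    D (λ x y → D (λ x₁ x₂ → G x₁ x₂ y) x) (a ∷ α)
      ≈⟨ D-∷ _ a α ⟩
    D (λ x₁ x₂ → G x₁ x₂ (a ∷ α)) [] + D (λ x y → D (λ x₁ x₂ → G x₁ x₂ y) (a ∷ x)) α
      ≈⟨ +-cong (+-identityʳ _) (trans (D-cong α (λ x y → D-∷ _ a x)) (D-+ α)) ⟩
    G [] [] (a ∷ α) + (D (λ x y → G [] (a ∷ x) y) α + D (λ x y → D (λ x₁ x₂ → G (a ∷ x₁) x₂ y) x) α)
      ≈⟨ trans (sym (+-assoc _ _ _)) (+-cong (sym (D-∷ (G []) a α)) (D-coassoc _ α)) ⟩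
    D (G []) (a ∷ α) + D (λ x y → D (λ y₁ y₂ → G (a ∷ x) y₁ y₂) y) α
      ≈⟨ D-∷ _ a α ⟨
    D (λ x y → D (λ y₁ y₂ → G x y₁ y₂) y) (a ∷ α) ∎

  -- The value of `H` on the product of `M_β₁ ⊗ M_β₂` and `M_γ₁ ⊗ M_γ₂` in the tensor square.
  sh² : (Comp → Comp → Carrier) → Comp → Comp → Comp → Comp → Carrier
  sh² H β₁ β₂ γ₁ γ₂ = sh (λ s → sh (H s) β₂ γ₂) β₁ γ₁

  -- The coproduct is an algebra map. A cut of a quasi-shuffle either precedes its first letter or
  -- keeps that letter on the left; in the second case the letter is absorbed into `H`, and the rest
  -- is an instance for shorter words.
  D-sh : ∀ H β γ → sh (D H) β γ ≈ D (λ β₁ β₂ → D (λ γ₁ γ₂ → sh² H β₁ β₂ γ₁ γ₂) γ) β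
  D-sh H [] γ = begin
    sh (D H) [] γ                    ≈⟨ sh-[]ˡ (D H) γ ⟩
    D H γ                            ≈⟨ D-cong γ (λ x y → trans (+-identityʳ _) (+-identityʳ _)) ⟨
    D (λ γ₁ γ₂ → sh² H [] [] γ₁ γ₂) γ ≈⟨ D-[] (λ β₁ β₂ → D (λ γ₁ γ₂ → sh² H β₁ β₂ γ₁ γ₂) γ) ⟨
    D (λ β₁ β₂ → D (λ γ₁ γ₂ → sh² H β₁ β₂ γ₁ γ₂) γ) [] ∎
  D-sh H (a ∷ β) [] = begin
    sh (D H) (a ∷ β) []              ≈⟨ sh-[]ʳ (D H) (a ∷ β) ⟩
    D H (a ∷ β)                      ≈⟨ D-cong (a ∷ β) (λ x y → trans (D-[] (sh² H x y))
                                          (trans (sh-[]ʳ (λ s → sh (H s) y []) x) (sh-[]ʳ (H x) y))) ⟨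
    D (λ β₁ β₂ → D (λ γ₁ γ₂ → sh² H β₁ β₂ γ₁ γ₂) []) (a ∷ β) ∎
  D-sh H s@(a ∷ β) t@(b ∷ γ) = begin
    sh (D H) s t
      ≈⟨ trans (sh-∷ (D H) a β b γ) (+-cong (part a β t) (+-cong (part b s γ) (part (suc (a ℕ.+ b)) β γ))) ⟩
    (_ + _) + ((_ + _) + (_ + _))
      ≈⟨ solve 6 (λ p p′ q q′ r r′ → (p :+ p′) :+ ((q :+ q′) :+ (r :+ r′))
           := (p :+ (q :+ r)) :+ (p′ :+ (q′ :+ r′))) refl _ _ _ _ _ _ ⟩
    _ + (D (λ β₁ β₂ → D (sh² (H′ a) β₁ β₂) t) β + (D (λ β₁ β₂ → D (sh² (H′ b) β₁ β₂) γ) s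
       + D (λ β₁ β₂ → D (sh² (H′ (suc (a ℕ.+ b))) β₁ β₂) γ) β))
      ≈⟨ +-cong (sym (sh-∷ (H []) a β b γ))
          (+-cong (trans (D-cong β (λ β₁ β₂ → D-∷ (sh² (H′ a) β₁ β₂) b γ)) (D-+ β)) (+-congʳ (D-∷ _ a β))) ⟩
    sh (H []) s t + ((D (λ β₁ β₂ → sh² (H′ a) β₁ β₂ [] t) β + _) + ((D (sh² (H′ b) [] s) γ + _) + _))
      -- Regrouped by whether the left part of `s` is empty, then by whether that of `t` is: the
      -- order in which `D-∷` opens the right-hand side.
      ≈⟨ solve 6 (λ p q q′ r r′ z → p :+ ((q :+ q′) :+ ((r :+ r′) :+ z))
           := (p :+ r) :+ (q :+ (q′ :+ (r′ :+ z)))) refl _ _ _ _ _ _ ⟩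
    (sh (H []) s t + D (sh² (H′ b) [] s) γ)
      + (D (λ β₁ β₂ → sh² (H′ a) β₁ β₂ [] t) β
        + (D (λ β₁ β₂ → D (λ γ₁ γ₂ → sh² (H′ a) β₁ β₂ (b ∷ γ₁) γ₂) γ) β
        + (D (λ β₁ β₂ → D (λ γ₁ γ₂ → sh² (H′ b) (a ∷ β₁) β₂ γ₁ γ₂) γ) β
        + D (λ β₁ β₂ → D (λ γ₁ γ₂ → sh² (H′ (suc (a ℕ.+ b))) β₁ β₂ γ₁ γ₂) γ) β)))
      ≈⟨ +-cong (+-cong (sym (+-identityʳ _))
                  (D-cong γ (λ γ₁ γ₂ → trans (+-identityʳ _) (sym (+-identityʳ _)))))
          (+-cong (D-cong β (λ β₁ β₂ → trans (sh-[]ʳ (λ s → sh (H (a ∷ s)) β₂ t) β₁) (sym (+-identityʳ _))))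
                  (trans (+-congˡ (trans (sym (D-+ β)) (D-cong β (λ _ _ → sym (D-+ γ)))))
                  (trans (sym (D-+ β)) (D-cong β (λ β₁ β₂ → trans (sym (D-+ γ))
                    (D-cong γ (λ γ₁ γ₂ → sym (sh-∷ (λ s → sh (H s) β₂ γ₂) a β₁ b γ₁)))))))) ⟩
    (sh² H [] s [] t + D (λ γ₁ γ₂ → sh² H [] s (b ∷ γ₁) γ₂) γ)
      + (D (λ β₁ β₂ → sh² H (a ∷ β₁) β₂ [] t) β
        + D (λ β₁ β₂ → D (λ γ₁ γ₂ → sh² H (a ∷ β₁) β₂ (b ∷ γ₁) γ₂) γ) β)
      ≈⟨ +-cong (D-∷ _ b γ) (trans (D-cong β (λ β₁ β₂ → D-∷ _ b γ)) (D-+ β)) ⟨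
    D (sh² H [] s) t + D (λ β₁ β₂ → D (sh² H (a ∷ β₁) β₂) t) β
      ≈⟨ D-∷ _ a β ⟨
    D (λ β₁ β₂ → D (sh² H β₁ β₂) t) s ∎
    where
    H′ : ℕ → Comp → Comp → Carrier
    H′ n x y = H (n ∷ x) y

    part : ∀ n p q → sh (D H ∘ (n ∷_)) p q ≈
           sh (H [] ∘ (n ∷_)) p q + D (λ β₁ β₂ → D (sh² (H′ n) β₁ β₂) q) p
    part n p q = trans (sh-cong p q (λ ε → D-∷ H n ε)) (trans (sh-+ p q) (+-congˡ (D-sh (H′ n) p q)))

-- Lyndon words and the uniqueness of Lyndon factorizations.

private
  module Lex = StrictTotalOrder (<-strictTotalOrder ℕₚ.<-strictTotalOrder)

_≺_ : Comp → Comp → Set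
_≺_ = Lex-< _≡_ ℕ._<_

≺-irrefl : ∀ {u} → ¬ (u ≺ u)
≺-irrefl = Lex.irrefl (≡⇒Pointwise-≡ ≡.refl)

lex<⇒≺ : ∀ u v → T (lex< u v) → u ≺ v
lex<⇒≺ []      (y ∷ v) _ = halt
lex<⇒≺ (x ∷ u) (y ∷ v) t with x ℕ.<ᵇ y in lt
... | true  = this (ℕₚ.<ᵇ⇒< x y (≡.subst T (≡.sym lt) _))
... | false with x ℕ.≡ᵇ y in eq
...   | true = next (ℕₚ.≡ᵇ⇒≡ x y (≡.subst T (≡.sym eq) _)) (lex<⇒≺ u v t)

≺-cancelˡ : ∀ p {u v} → (p ++ u) ≺ (p ++ v) → u ≺ v
≺-cancelˡ []      u≺v           = u≺v
≺-cancelˡ (x ∷ p) (this x<x)    = contradiction x<x (ℕₚ.<-irrefl ≡.refl)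
≺-cancelˡ (x ∷ p) (next _ u≺v)  = ≺-cancelˡ p u≺v

≺-extendʳ : ∀ {u v} w → u ≺ v → u ≺ (v ++ w)
≺-extendʳ w halt           = halt
≺-extendʳ w (this x<y)     = this x<y
≺-extendʳ w (next x≡y u≺v) = next x≡y (≺-extendʳ w u≺v)

prefix-≺ : ∀ p a u → p ≺ (p ++ a ∷ u)
prefix-≺ []      a u = halt
prefix-≺ (x ∷ p) a u = next ≡.refl (prefix-≺ p a u)

-- A comparison decided at a letter survives every continuation of both words, one decided by length
-- need not; the arguments on rotations split along this line.
≺-prefix-or-mismatch : ∀ {u v} → u ≺ v → (∃ λ t → v ≡ u ++ t) ⊎ (∀ s t → (u ++ s) ≺ (v ++ t))
≺-prefix-or-mismatch halt       = inj₁ (_ , ≡.refl)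
≺-prefix-or-mismatch (this x<y) = inj₂ (λ _ _ → this x<y)
≺-prefix-or-mismatch (next ≡.refl u≺v) with ≺-prefix-or-mismatch u≺v
... | inj₁ (t , ≡.refl) = inj₁ (t , ≡.refl)
... | inj₂ mismatch     = inj₂ (λ s t → next ≡.refl (mismatch s t))

allB-lookup : ∀ {A : Set} (p : A → Bool) {xs x} → T (allB p xs) → x ∈ xs → T (p x)
allB-lookup p t (here ≡.refl) = proj₁ (Equivalence.to T-∧ t)
allB-lookup p {x ∷ xs} t (there x∈) = allB-lookup p (proj₂ (Equivalence.to (T-∧ {x = p x}) t)) x∈

take-length-++ : ∀ (u v : Comp) → take (length u) (u ++ v) ≡ u
take-length-++ []      v = ≡.refl
take-length-++ (x ∷ u) v = ≡.cong (x ∷_) (take-length-++ u v)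

take-length+-++ : ∀ (u v : Comp) j → take (length u ℕ.+ j) (u ++ v) ≡ u ++ take j v
take-length+-++ []      v j = ≡.refl
take-length+-++ (x ∷ u) v j = ≡.cong (x ∷_) (take-length+-++ u v j)

drop-length-++ : ∀ (u v : Comp) → drop (length u) (u ++ v) ≡ v
drop-length-++ []      v = ≡.refl
drop-length-++ (x ∷ u) v = drop-length-++ u v

rotate-++ : ∀ u v → rotate (length u) (u ++ v) ≡ v ++ u
rotate-++ u v = ≡.cong₂ _++_ (drop-length-++ u v) (take-length-++ u v)

Lyndon-≺-rotation : ∀ a u b v → IsLyndon (a ∷ u ++ b ∷ v) → (a ∷ u ++ b ∷ v) ≺ (b ∷ v ++ a ∷ u)
Lyndon-≺-rotation a u b v lyn = ≡.subst ((a ∷ u ++ b ∷ v) ≺_) (rotate-++ (a ∷ u) (b ∷ v))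
  -- `isLyndon` tests the rotations by `suc i`, so moving `a ∷ u` to the end is the test at index
  -- `length u`.
  (lex<⇒≺ (a ∷ u ++ b ∷ v) _ (allB-lookup _ lyn (∈-upTo⁺ shorter)))
  where
  shorter : length u ℕ.< length (u ++ b ∷ v)
  shorter = ≡.subst (length u ℕ.<_) (≡.sym (length-++ u)) (ℕₚ.m<m+n (length u) (ℕ.s≤s ℕ.z≤n))

-- If the suffix were smaller by a mismatch, the rotation beginning with it would be smaller than
-- the word as well. If it were smaller as a prefix, the word would have a border, and a second
-- rotation excludes that.
Lyndon-≺-suffix : ∀ a u b v → IsLyndon (a ∷ u ++ b ∷ v) → (a ∷ u ++ b ∷ v) ≺ (b ∷ v)
Lyndon-≺-suffix a u b v lyn with Lex.compare (a ∷ u ++ b ∷ v) (b ∷ v)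
... | tri< w≺v _ _ = w≺v
... | tri≈ _ w≈v _ = contradiction
  (≡.trans (≡.sym (length-++ (a ∷ u))) (≡.cong length (Pointwise-≡⇒≡ w≈v)))
  (ℕₚ.<⇒≢ (ℕₚ.m<n+m _ (ℕ.s≤s ℕ.z≤n)) ∘ ≡.sym)
... | tri> _ _ v≺w with ≺-prefix-or-mismatch v≺w
...   | inj₂ mismatch = contradiction (Lyndon-≺-rotation a u b v lyn)
  (Lex.asym (≡.subst ((b ∷ v ++ a ∷ u) ≺_) (++-identityʳ _) (mismatch (a ∷ u) [])))
-- w = (a ∷ u) ++ (b ∷ v) = (b ∷ v) ++ t gives t ≺ a ∷ u, of equal length, so the rotation t ++ (b ∷ v) is below w.
...   | inj₁ (t , w≡vt) = below-own-rotation t w≡vt t≺u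
  where
  t≺u : t ≺ (a ∷ u)
  t≺u = ≺-cancelˡ (b ∷ v) (≡.subst (_≺ (b ∷ v ++ a ∷ u)) w≡vt (Lyndon-≺-rotation a u b v lyn))
  below-own-rotation : ∀ t → a ∷ u ++ b ∷ v ≡ b ∷ v ++ t → t ≺ (a ∷ u) → (a ∷ u ++ b ∷ v) ≺ (b ∷ v)
  below-own-rotation []      eq _ = contradiction
    (≡.trans (≡.sym (length-++ (a ∷ u))) (≡.trans (≡.cong length eq) (≡.cong length (++-identityʳ (b ∷ v)))))
    (ℕₚ.<⇒≢ (ℕₚ.m<n+m _ (ℕ.s≤s ℕ.z≤n)) ∘ ≡.sym)
  below-own-rotation (d ∷ t) eq t≺u′ with ≺-prefix-or-mismatch t≺u′
  ... | inj₂ mismatch = contradiction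
    (≡.subst (_≺ (d ∷ t ++ b ∷ v)) (≡.sym eq)
      (Lyndon-≺-rotation b v d t (≡.subst IsLyndon eq lyn)))
    (Lex.asym (mismatch (b ∷ v) (b ∷ v)))
  -- `d ∷ t` and `a ∷ u` have equal length, both completing `b ∷ v` to the same word, so neither is
  -- a proper prefix of the other.
  ... | inj₁ ([] , u≡t) = contradiction
    (≡.subst (_≺ (a ∷ u)) (≡.trans (≡.sym (++-identityʳ _)) (≡.sym u≡t)) t≺u′) ≺-irrefl
  ... | inj₁ (s@(_ ∷ _) , u≡ts) = contradiction lengths
    (ℕₚ.<⇒≢ (ℕₚ.≤-trans (ℕₚ.m<m+n _ (ℕ.s≤s ℕ.z≤n)) (ℕₚ.≤-reflexive (≡.sym (length-++ (d ∷ t))))))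
    where
    lengths : length (d ∷ t) ≡ length ((d ∷ t) ++ s)
    lengths = ≡.trans (ℕₚ.+-cancelˡ-≡ (length (b ∷ v)) _ _
      (≡.trans (≡.sym (length-++ (b ∷ v))) (≡.trans (≡.cong length (≡.sym eq))
        (≡.trans (length-++ (a ∷ u)) (ℕₚ.+-comm (length (a ∷ u)) _)))))
      (≡.cong length u≡ts)

LynComp-≡ : ∀ {v w : LynComp} → proj₁ v ≡ proj₁ w → v ≡ w
LynComp-≡ {v , p} {.v , q} ≡.refl = ≡.cong (v ,_) (T-irrelevant p q)

_≽_ : LynComp → LynComp → Set
v ≽ w = ¬ (proj₁ v ≺ proj₁ w)

≽-trans : ∀ {v w x} → v ≽ w → w ≽ x → v ≽ x
≽-trans {v} {w} {x} v≽w w≽x v≺x with Lex.compare (proj₁ v) (proj₁ w)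
... | tri< v≺w _ _ = v≽w v≺w
... | tri≈ _ v≈w _ = w≽x (≡.subst (_≺ proj₁ x) (Pointwise-≡⇒≡ v≈w) v≺x)
... | tri> _ _ w≺v = w≽x (Lex.trans w≺v v≺x)

insert : LynComp → List LynComp → List LynComp
insert v []      = v ∷ []
insert v (w ∷ m) with proj₁ v Lex.<? proj₁ w
... | yes _ = w ∷ insert v m
... | no  _ = v ∷ w ∷ m

sort : List LynComp → List LynComp
sort = foldr insert []

insert-↭ : ∀ v m → insert v m ↭ v ∷ m
insert-↭ v []      = ↭-refl
insert-↭ v (w ∷ m) with proj₁ v Lex.<? proj₁ w
... | yes _ = ↭-trans (prep w (insert-↭ v m)) (swap w v ↭-refl)
... | no  _ = ↭-refl

sort-↭ : ∀ m → sort m ↭ m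
sort-↭ []      = ↭-refl
sort-↭ (v ∷ m) = ↭-trans (insert-↭ v (sort m)) (prep v (sort-↭ m))

insert-sorted : ∀ v {m} → AllPairs _≽_ m → AllPairs _≽_ (insert v m)
insert-sorted v []            = [] ∷ []
insert-sorted v {w ∷ m} (w≽m ∷ m-sorted) with proj₁ v Lex.<? proj₁ w
... | yes v≺w = ↭.All-resp-↭ (↭-sym (insert-↭ v m)) (Lex.asym v≺w ∷ w≽m) ∷ insert-sorted v m-sorted
... | no  v≽w = (v≽w ∷ All.map (λ {x} → ≽-trans {v} {w} {x} v≽w) w≽m) ∷ w≽m ∷ m-sorted

sort-sorted : ∀ m → AllPairs _≽_ (sort m)
sort-sorted []      = []
sort-sorted (v ∷ m) = insert-sorted v (sort-sorted m)

word : List LynComp → Comp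
word = concatMap proj₁

longestLyndonPrefix : ℕ → Comp → Maybe (LynComp × Comp)
longestLyndonPrefix zero    w = nothing
longestLyndonPrefix (suc i) w with T? (isLyndon (take (suc i) w))
... | yes lyn = just ((take (suc i) w , lyn) , drop (suc i) w)
... | no  _   = longestLyndonPrefix i w

-- The number is fuel; the length of the word is enough, since every Lyndon factor is nonempty.
factor : ℕ → Comp → List LynComp
factor zero    w = []
factor (suc n) w with longestLyndonPrefix (length w) w
... | nothing      = []
... | just (v , r) = v ∷ factor n r

-- The boundary case `s ≡ l` falls under the first alternative, which keeps `s′` nonempty in the
-- second.
++-split : ∀ s {t} l {r : Comp} → s ++ t ≡ l ++ r → s ≢ [] →
           (∃ λ q → l ≡ s ++ q) ⊎ (∃ λ s′ → s′ ≢ [] × s ≡ l ++ s′ × s′ ++ t ≡ r)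
++-split []      l       eq s≢[] = contradiction ≡.refl s≢[]
++-split (x ∷ s) []      eq s≢[] = inj₂ (x ∷ s , s≢[] , ≡.refl , eq)
++-split (x ∷ []) (y ∷ l) eq s≢[] = inj₁ (l , ≡.cong (_∷ l) (≡.sym (∷-injectiveˡ eq)))
++-split (x ∷ s@(_ ∷ _)) (y ∷ l) eq s≢[] with ∷-injectiveˡ eq | ++-split s l (∷-injectiveʳ eq) (λ ())
... | ≡.refl | inj₁ (q , l≡)                    = inj₁ (q , ≡.cong (x ∷_) l≡)
... | ≡.refl | inj₂ (s′ , s′≢[] , s≡ , r≡)      = inj₂ (s′ , s′≢[] , ≡.cong (x ∷_) s≡ , r≡)

-- `s₂` is what `s` covers of the last factor w that it reaches. As a prefix of w it cannot exceed
-- `v`, for then w would too.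
prefix-last-piece : ∀ v m → All (v ≽_) m → ∀ s t → s ++ t ≡ word m → s ≢ [] →
                    ∃ λ s₁ → ∃ λ s₂ → s ≡ s₁ ++ s₂ × s₂ ≢ [] × ¬ (proj₁ v ≺ s₂)
prefix-last-piece v []      []          []      t eq s≢[] = contradiction ≡.refl s≢[]
prefix-last-piece v (w ∷ m) (v≽w ∷ v≽m) s       t eq s≢[] with ++-split s (proj₁ w) eq s≢[]
... | inj₁ (q , w≡sq) = [] , s , ≡.refl , s≢[] ,
  λ v≺s → v≽w (≡.subst (proj₁ v ≺_) (≡.sym w≡sq) (≺-extendʳ q v≺s))
... | inj₂ (s′ , s′≢[] , s≡ , eq′) with prefix-last-piece v m v≽m s′ t eq′ s′≢[]
...   | s₁ , s₂ , s′≡ , s₂≢[] , v⊀s₂ =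
  proj₁ w ++ s₁ , s₂ , ≡.trans s≡ (≡.trans (≡.cong (proj₁ w ++_) s′≡) (≡.sym (++-assoc (proj₁ w) s₁ s₂))) , s₂≢[] , v⊀s₂

-- A Lyndon word v ++ s with s ≢ [] is smaller than its suffix s₂ ≼ v, yet larger than its prefix v.
no-longer-Lyndon-prefix : ∀ v m → All (v ≽_) m → ∀ s t → s ++ t ≡ word m → s ≢ [] → ¬ IsLyndon (proj₁ v ++ s)
no-longer-Lyndon-prefix v@(a ∷ u , _) m v≽m s t eq s≢[] lyn with prefix-last-piece v m v≽m s t eq s≢[]
... | s₁ , []     , s≡ , s₂≢[] , _    = contradiction ≡.refl s₂≢[]
... | s₁ , b ∷ s₂ , s≡ , _     , v⊀s₂ = v⊀s₂ (Lex.trans (v≺vs s s≢[])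
  (≡.subst (_≺ (b ∷ s₂)) (≡.sym vs≡) (Lyndon-≺-suffix a (u ++ s₁) b s₂ (≡.subst IsLyndon vs≡ lyn))))
  where
  vs≡ : a ∷ u ++ s ≡ a ∷ (u ++ s₁) ++ b ∷ s₂
  vs≡ = ≡.trans (≡.cong ((a ∷ u) ++_) s≡) (≡.sym (++-assoc (a ∷ u) s₁ (b ∷ s₂)))
  v≺vs : ∀ s → s ≢ [] → (a ∷ u) ≺ (a ∷ u ++ s)
  v≺vs []      s≢[] = contradiction ≡.refl s≢[]
  v≺vs (x ∷ s) _    = prefix-≺ (a ∷ u) x s

longestLyndonPrefix-hit : ∀ i w (lyn : IsLyndon (take (suc i) w)) →
  longestLyndonPrefix (suc i) w ≡ just ((take (suc i) w , lyn) , drop (suc i) w)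
longestLyndonPrefix-hit i w lyn with T? (isLyndon (take (suc i) w))
... | yes lyn′ = ≡.cong (λ l → just ((take (suc i) w , l) , drop (suc i) w)) (T-irrelevant lyn′ lyn)
... | no ¬lyn  = contradiction lyn ¬lyn

longestLyndonPrefix-miss : ∀ i w → ¬ IsLyndon (take (suc i) w) →
  longestLyndonPrefix (suc i) w ≡ longestLyndonPrefix i w
longestLyndonPrefix-miss i w ¬lyn with T? (isLyndon (take (suc i) w))
... | yes lyn = contradiction lyn ¬lyn
... | no  _   = ≡.refl

-- Induction on the surplus `j` over the length of `v`: every longer candidate is refused by
-- `no-longer-Lyndon-prefix`, and at surplus zero the search stops at `v` itself.
longestLyndonPrefix-word : ∀ v m → All (v ≽_) m → ∀ j → j ℕ.≤ length (word m) →
  longestLyndonPrefix (length (proj₁ v) ℕ.+ j) (proj₁ v ++ word m) ≡ just (v , word m)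
longestLyndonPrefix-word v@(a ∷ u , lyn) m v≽m zero _ =
  ≡.trans (≡.cong (λ i → longestLyndonPrefix i (a ∷ u ++ word m)) (ℕₚ.+-identityʳ (suc (length u))))
    (≡.trans (longestLyndonPrefix-hit (length u) _ (≡.subst IsLyndon (≡.sym prefix) lyn))
      (≡.cong₂ (λ x y → just (x , y)) (LynComp-≡ prefix) (drop-length-++ (a ∷ u) (word m))))
  where
  prefix : take (suc (length u)) (a ∷ u ++ word m) ≡ a ∷ u
  prefix = take-length-++ (a ∷ u) (word m)
longestLyndonPrefix-word v@(a ∷ u , lyn) m v≽m (suc j) j< =
  ≡.trans (≡.cong (λ i → longestLyndonPrefix i (a ∷ u ++ word m)) (ℕₚ.+-suc (suc (length u)) j))
    (≡.trans (longestLyndonPrefix-miss (length (a ∷ u) ℕ.+ j) _ not-Lyndon)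
      (longestLyndonPrefix-word v m v≽m j (ℕₚ.<⇒≤ j<)))
  where
  nonempty : ∀ w → suc j ℕ.≤ length w → take (suc j) w ≢ []
  nonempty (x ∷ w) _ ()
  not-Lyndon : ¬ IsLyndon (take (suc (length (a ∷ u) ℕ.+ j)) (a ∷ u ++ word m))
  not-Lyndon lyn′ = no-longer-Lyndon-prefix v m v≽m (take (suc j) (word m)) (drop (suc j) (word m))
    (take++drop≡id (suc j) (word m)) (nonempty (word m) j<)
    (≡.subst IsLyndon (≡.trans (≡.cong (λ i → take i (a ∷ u ++ word m)) (≡.sym (ℕₚ.+-suc (suc (length u)) j)))
      (take-length+-++ (a ∷ u) (word m) (suc j))) lyn′)

factor-word : ∀ m → AllPairs _≽_ m → ∀ n → length m ℕ.≤ n → factor n (word m) ≡ m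
factor-word []      _                zero    _ = ≡.refl
factor-word []      _                (suc n) _ = ≡.refl
factor-word (v ∷ m) (v≽m ∷ m-sorted) (suc n) (ℕ.s≤s m≤n)
  rewrite length-++ (proj₁ v) {word m} | longestLyndonPrefix-word v m v≽m (length (word m)) ℕₚ.≤-refl
  = ≡.cong (v ∷_) (factor-word m m-sorted n m≤n)

length≤length-word : ∀ m → length m ℕ.≤ length (word m)
length≤length-word [] = ℕ.z≤n
length≤length-word ((a ∷ u , _) ∷ m) = ℕ.s≤s (≡.subst (length m ℕ.≤_) (≡.sym (length-++ u))
  (ℕₚ.≤-trans (length≤length-word m) (ℕₚ.m≤n+m _ (length u))))

-- Chen–Fox–Lyndon: a monomial in Lyndon variables is recovered, up to order, from the
-- concatenation of its variables in weakly decreasing order.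
monomialWord : List LynComp → Comp
monomialWord m = word (sort m)

wordMonomial : Comp → List LynComp
wordMonomial w = factor (length w) w

wordMonomial-monomialWord : ∀ m → wordMonomial (monomialWord m) ↭ m
wordMonomial-monomialWord m = ↭-trans
  (≡.subst (_↭ sort m) (≡.sym (factor-word (sort m) (sort-sorted m) _ (length≤length-word (sort m)))) ↭-refl)
  (sort-↭ m)

-- Compositions of bounded size and weights of monomials.

-- `π` recovers from an element the index of its block, so blocks of distinct indices are disjoint.
concatMap-! : ∀ {X Y : Set} (π : Y → X) {g : X → List Y} {xs} → (∀ x {y} → y ∈ g x → π y ≡ x) →
              (∀ x → Unique (g x)) → Unique xs → Unique (concatMap g xs)
concatMap-! π {g} {xs} section g! xs! = Uniqueₚ.concat⁺ (Allₚ.map⁺ (All.tabulate (λ {x} _ → g! x)))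
  (AllPairsₚ.map⁺ (AllPairs.map (λ x≢y {_} (z∈gx , z∈gy) → x≢y (≡.trans (≡.sym (section _ z∈gx)) (section _ z∈gy))) xs!))

lookup-injective : ∀ {X : Set} {xs : List X} → Unique xs → ∀ i j → lookup xs i ≡ lookup xs j → i ≡ j
lookup-injective (x∉ ∷ xs!) zero    zero    eq = ≡.refl
lookup-injective (x∉ ∷ xs!) zero    (suc j) eq = contradiction eq (All.lookup x∉ (∈-lookup j))
lookup-injective (x∉ ∷ xs!) (suc i) zero    eq = contradiction (≡.sym eq) (All.lookup x∉ (∈-lookup i))
lookup-injective (x∉ ∷ xs!) (suc i) (suc j) eq = ≡.cong suc (lookup-injective xs! i j eq)

∈-comps⁻ : ∀ n {α} → α ∈ comps n → size α ≡ n
∈-comps⁻ zero    (here ≡.refl) = ≡.refl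
∈-comps⁻ (suc n) α∈ with find (∈-concatMap⁻ _ {xs = comps n} α∈)
... | []    , w∈ , here ≡.refl         = ≡.cong suc (∈-comps⁻ n w∈)
... | _ ∷ _ , w∈ , here ≡.refl         = ≡.cong suc (∈-comps⁻ n w∈)
... | _ ∷ _ , w∈ , there (here ≡.refl) = ≡.cong suc (∈-comps⁻ n w∈)

∈-comps⁺ : ∀ α → α ∈ comps (size α)
∈-comps⁺ []      = here ≡.refl
∈-comps⁺ (a ∷ γ) = nonempty a γ
  where
  step∈ : ∀ n {w α} → w ∈ comps n → α ∈ _ → α ∈ comps (suc n)
  step∈ n w∈ α∈ = ∈-concatMap⁺ _ (Any.map (λ { ≡.refl → α∈ }) w∈)
  nonempty : ∀ a γ → (a ∷ γ) ∈ comps (size (a ∷ γ))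
  nonempty zero    []      = here ≡.refl
  nonempty zero    (b ∷ γ) = step∈ (size (b ∷ γ)) (nonempty b γ) (here ≡.refl)
  nonempty (suc a) γ       = step∈ (size (a ∷ γ)) (nonempty a γ) (there (here ≡.refl))

comps-! : ∀ n → Unique (comps n)
comps-! zero    = [] ∷ []
comps-! (suc n) = concatMap-! parent
  (λ { []      (here ≡.refl)         → ≡.refl
     ; (_ ∷ _) (here ≡.refl)         → ≡.refl
     ; (_ ∷ _) (there (here ≡.refl)) → ≡.refl })
  (λ { []      → [] ∷ []
     ; (_ ∷ _) → ((λ ()) ∷ []) ∷ [] ∷ [] })
  (comps-! n)
  where
  -- Undoes one generation step: a leading part 1 is dropped, a larger first part is decreased.
  parent : Comp → Comp
  parent []          = []
  parent (zero ∷ γ)  = γ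
  parent (suc a ∷ γ) = a ∷ γ

comps≤ : ℕ → List Comp
comps≤ n = concatMap comps (upTo (suc n))

comps≤-! : ∀ n → Unique (comps≤ n)
comps≤-! n = concatMap-! size (λ k → ∈-comps⁻ k) comps-! (Uniqueₚ.upTo⁺ (suc n))

∈-comps≤⁺ : ∀ {n} α → size α ℕ.≤ n → α ∈ comps≤ n
∈-comps≤⁺ α α≤n = ∈-concatMap⁺ comps (Any.map (λ { ≡.refl → ∈-comps⁺ α }) (∈-upTo⁺ (ℕ.s≤s α≤n)))

∈-comps≤⁻ : ∀ n {α} → α ∈ comps≤ n → size α ℕ.≤ n
∈-comps≤⁻ n α∈ with find (∈-concatMap⁻ comps {xs = upTo (suc n)} α∈)
... | k , k∈ , α∈k = ℕ.s≤s⁻¹ (≡.subst (ℕ._< suc n) (≡.sym (∈-comps⁻ k α∈k)) (∈-upTo⁻ k∈))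

weight : List LynComp → ℕ
weight m = sum (map (size ∘ proj₁) m)

size-++ : ∀ α β → size (α ++ β) ≡ size α ℕ.+ size β
size-++ α β = ≡.trans (≡.cong sum (map-++ suc α β)) (sum-++ (map suc α) (map suc β))

size-word : ∀ m → size (word m) ≡ weight m
size-word []      = ≡.refl
size-word (v ∷ m) = ≡.trans (size-++ (proj₁ v) (word m)) (≡.cong (size (proj₁ v) ℕ.+_) (size-word m))

size-monomialWord : ∀ m → size (monomialWord m) ≡ weight m
size-monomialWord m = ≡.trans (size-word (sort m)) (sum-↭ (↭.map⁺ _ (sort-↭ m)))

-- Linear dependence of more vectors than coordinates.

module LinearDependence {c ℓ : Level} (R : RealField c ℓ) where
  open RealField R hiding (zero)
  open Sums commutativeRing
  open RingProperties ring
  open RingSolver commutativeSemiring using (solve; _:=_; _:+_; _:*_)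
  open SetoidReasoning setoid

  -- Elimination has to search for a nonzero entry; trichotomy of the order makes the search
  -- possible.
  _≈?_ : ∀ x y → Dec (x ≈ y)
  x ≈? y with <-trichot x y
  ... | inj₁ x<y        = no (λ x≈y → <-irrefl (<-resp-≈ x≈y refl x<y))
  ... | inj₂ (inj₁ x≈y) = yes x≈y
  ... | inj₂ (inj₂ y<x) = no (λ x≈y → <-irrefl (<-resp-≈ refl x≈y y<x))

  *-cancel-0 : ∀ {x y} → ¬ (x ≈ 0#) → x * y ≈ 0# → y ≈ 0#
  *-cancel-0 {x} {y} x≉0 xy≈0 = let x⁻¹ , xx⁻¹≈1 = inverse x x≉0 in begin
    y             ≈⟨ *-identityˡ y ⟨
    1# * y        ≈⟨ *-congʳ xx⁻¹≈1 ⟨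
    x * x⁻¹ * y   ≈⟨ solve 3 (λ p q r → p :* q :* r := q :* (p :* r)) refl x x⁻¹ y ⟩
    x⁻¹ * (x * y) ≈⟨ *-congˡ xy≈0 ⟩
    x⁻¹ * 0#      ≈⟨ zeroʳ x⁻¹ ⟩
    0#            ∎

  ∑-allFin-suc : ∀ n {f : Fin (suc n) → Carrier} → ∑ (allFin (suc n)) f ≈ f zero + ∑ (allFin n) (f ∘ suc)
  ∑-allFin-suc n {f} = +-congˡ (trans (reflexive (≡.cong (λ is → ∑ is f) (≡.sym (map-tabulate (λ i → i) suc))))
    (∑-map suc (allFin n)))

  -- Gaussian elimination. If the first vector vanishes on `S`, it is a dependency by itself.
  -- Otherwise it has a pivot `p`; multiples of it clear the other vectors at `p`, and these are
  -- dependent on `S` without `p` by induction.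
  dependent : ∀ n (S : List Comp) (V : Fin n → Comp → Carrier) → length S ℕ.< n →
    Σ (Fin n → Carrier) λ k → (∃ λ j → ¬ (k j ≈ 0#)) ×
      (∀ {s} → s ∈ S → ∑ (allFin n) (λ j → k j * V j s) ≈ 0#)
  dependent (suc n) S V S<n with Any.any? (λ s → ¬? (V zero s ≈? 0#)) S
  ... | no all-zero = k , (zero , λ 1≈0 → 0≉1 (sym 1≈0)) , λ {s} s∈ → begin
    ∑ (allFin (suc n)) (λ j → k j * V j s)          ≈⟨ ∑-allFin-suc n ⟩
    1# * V zero s + ∑ (allFin n) (λ j → 0# * V (suc j) s)
      ≈⟨ +-cong (trans (*-identityˡ _) (vanish s∈)) (∑-zero (allFin n) (λ _ → zeroˡ _)) ⟩
    0# + 0#                                         ≈⟨ +-identityˡ 0# ⟩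
    0#                                              ∎
    where
    k : Fin (suc n) → Carrier
    k zero    = 1#
    k (suc _) = 0#
    vanish : ∀ {s} → s ∈ S → V zero s ≈ 0#
    vanish {s} s∈ with V zero s ≈? 0#
    ... | yes v≈0 = v≈0
    ... | no  v≉0 = contradiction (Any.map (λ { ≡.refl → v≉0 }) s∈) all-zero
  ... | yes some with find some
  ...   | p , p∈ , v≉0 = k , (suc (proj₁ (proj₁ (proj₂ ih))) , proj₂ (proj₁ (proj₂ ih))) , vanish
    where
    v⁻¹ = proj₁ (inverse (V zero p) v≉0)
    V′ : Fin n → Comp → Carrier
    V′ j s = V (suc j) s + - (V (suc j) p * v⁻¹) * V zero s
    S′ = filter (λ s → ¬? (s ≟c p)) S
    ih = dependent n S′ V′ (ℕₚ.<-≤-trans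
      (filter-notAll (λ s → ¬? (s ≟c p)) S (Any.map (λ { ≡.refl p≢p → p≢p ≡.refl }) p∈)) (ℕ.s≤s⁻¹ S<n))
    k : Fin (suc n) → Carrier
    -- The total multiple of the first vector that occurs in the relation among the `V′ j`, so that
    -- this relation becomes one among the original vectors.
    k zero    = ∑ (allFin n) (λ j → proj₁ ih j * - (V (suc j) p * v⁻¹))
    k (suc j) = proj₁ ih j
    eliminated : ∀ j → V′ j p ≈ 0#
    eliminated j = begin
      V (suc j) p + - (V (suc j) p * v⁻¹) * V zero p
        ≈⟨ +-congˡ (-‿distribˡ-* _ _) ⟨
      V (suc j) p + - (V (suc j) p * v⁻¹ * V zero p)
        ≈⟨ +-congˡ (-‿cong (trans (solve 3 (λ x y z → x :* y :* z := x :* (z :* y)) refl _ _ _)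
             (trans (*-congˡ (proj₂ (inverse (V zero p) v≉0))) (*-identityʳ _)))) ⟩
      V (suc j) p + - V (suc j) p
        ≈⟨ -‿inverseʳ _ ⟩
      0# ∎
    -- The induction hypothesis is silent at `p`, where all the `V′ j` are zero anyway.
    vanish′ : ∀ {s} → s ∈ S → ∑ (allFin n) (λ j → proj₁ ih j * V′ j s) ≈ 0#
    vanish′ {s} s∈ with s ≟c p
    ... | yes ≡.refl = ∑-zero (allFin n) (λ {j} _ → trans (*-congˡ (eliminated j)) (zeroʳ _))
    ... | no  s≢p    = proj₂ (proj₂ ih) (∈-filter⁺ (λ s → ¬? (s ≟c p)) s∈ s≢p)
    vanish : ∀ {s} → s ∈ S → ∑ (allFin (suc n)) (λ j → k j * V j s) ≈ 0#
    vanish {s} s∈ = begin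
      ∑ (allFin (suc n)) (λ j → k j * V j s)
        ≈⟨ ∑-allFin-suc n ⟩
      k zero * V zero s + ∑ (allFin n) (λ j → k (suc j) * V (suc j) s)
        ≈⟨ +-congʳ (∑-*ʳ (allFin n) (V zero s)) ⟨
      ∑ (allFin n) (λ j → proj₁ ih j * - (V (suc j) p * v⁻¹) * V zero s) + ∑ (allFin n) (λ j → proj₁ ih j * V (suc j) s)
        ≈⟨ ∑-+ (allFin n) ⟨
      ∑ (allFin n) (λ j → proj₁ ih j * - (V (suc j) p * v⁻¹) * V zero s + proj₁ ih j * V (suc j) s)
        ≈⟨ ∑-cong (allFin n) (λ _ → solve 4 (λ x y z w → x :* y :* z :+ x :* w := x :* (w :+ y :* z)) refl _ _ _ _) ⟩
      ∑ (allFin n) (λ j → proj₁ ih j * V′ j s)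
        ≈⟨ vanish′ s∈ ⟩
      0# ∎

-- Algebraic independence of the Lyndon generators.

module Freeness {c ℓ : Level} (R : RealField c ℓ) where
  open RealField R hiding (zero)
  open QSym R
  open Pairing R
  open Bialgebra R
  open LinearDependence R
  open RingProperties ring
  open RingSolver commutativeSemiring using (solve; _:=_; _:+_; _:*_)
  open SetoidReasoning setoid

  monomial : List LynComp → Lin
  monomial = foldr (λ v → mul (basis (proj₁ v))) one

  monomialValue : (LynComp → Carrier) → List LynComp → Carrier
  monomialValue u = foldr (λ v r → u v * r) 1#

  evalU-∑ : ∀ u p → evalU u p ≈ ∑ p (λ t → proj₁ t * monomialValue u (proj₂ t))
  evalU-∑ u []      = refl
  evalU-∑ u (t ∷ p) = +-congˡ (evalU-∑ u p)

  pair-evalM : ∀ p {f} → ⟨ evalM p , f ⟩ ≈ ∑ p (λ t → proj₁ t * ⟨ monomial (proj₂ t) , f ⟩)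
  pair-evalM p = trans (∑-concatMap _ p) (∑-cong p (λ t → pair-scale (proj₁ t) (monomial (proj₂ t))))

  pair-monomial-∷ : ∀ v m {f} → ⟨ monomial (v ∷ m) , f ⟩ ≈ ⟨ monomial m , sh f (proj₁ v) ⟩
  pair-monomial-∷ v m {f} = trans (pair-mul (basis (proj₁ v)) (monomial m)) (pair-basis (proj₁ v) (λ β → ⟨ monomial m , sh f β ⟩))

  pair-monomial-++ : ∀ m m′ {f} → ⟨ monomial (m ++ m′) , f ⟩ ≈
                     ⟨ monomial m , (λ β → ⟨ monomial m′ , sh f β ⟩) ⟩
  pair-monomial-++ [] m′ {f} = sym (trans (pair-basis [] (λ β → ⟨ monomial m′ , sh f β ⟩)) (pair-cong (monomial m′) (sh-[]ˡ f)))
  pair-monomial-++ (v ∷ m) m′ {f} = begin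
    ⟨ monomial (v ∷ m ++ m′) , f ⟩
      ≈⟨ trans (pair-monomial-∷ v (m ++ m′)) (pair-monomial-++ m m′) ⟩
    ⟨ monomial m , (λ β → ⟨ monomial m′ , sh (sh f (proj₁ v)) β ⟩) ⟩
      ≈⟨ pair-cong (monomial m) (λ β → trans
          (pair-cong (monomial m′) (λ γ → sym (sh-assoc f (proj₁ v) β γ)))
          (pair-∑ (monomial m′) (qsh (proj₁ v) β))) ⟩
    ⟨ monomial m , sh (λ β → ⟨ monomial m′ , sh f β ⟩) (proj₁ v) ⟩
      ≈⟨ pair-monomial-∷ v m ⟨
    ⟨ monomial (v ∷ m) , (λ β → ⟨ monomial m′ , sh f β ⟩) ⟩ ∎

  -- Monomials are lists, so the variables commute only through the commutativity of the
  -- quasi-shuffle; in the swap case associativity first brings the two factors together.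
  pair-monomial-↭ : ∀ {m m′} → m ↭ m′ → ∀ f → ⟨ monomial m , f ⟩ ≈ ⟨ monomial m′ , f ⟩
  pair-monomial-↭ Perm.refl f = refl
  pair-monomial-↭ (prep {m} {m′} v m↭m′) f =
    trans (pair-monomial-∷ v m) (trans (pair-monomial-↭ m↭m′ _) (sym (pair-monomial-∷ v m′)))
  pair-monomial-↭ (swap {m} {m′} v w m↭m′) f = begin
    ⟨ monomial (v ∷ w ∷ m) , f ⟩
      ≈⟨ trans (pair-monomial-∷ v (w ∷ m)) (pair-monomial-∷ w m) ⟩
    ⟨ monomial m , sh (sh f (proj₁ v)) (proj₁ w) ⟩
      ≈⟨ pair-monomial-↭ m↭m′ _ ⟩
    ⟨ monomial m′ , sh (sh f (proj₁ v)) (proj₁ w) ⟩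
      ≈⟨ pair-cong (monomial m′) (λ γ → begin
           sh (sh f (proj₁ v)) (proj₁ w) γ              ≈⟨ sh-assoc f (proj₁ v) (proj₁ w) γ ⟨
           sh (λ ε → sh f ε γ) (proj₁ v) (proj₁ w)      ≈⟨ sh-comm _ (proj₁ v) (proj₁ w) ⟩
           sh (λ ε → sh f ε γ) (proj₁ w) (proj₁ v)      ≈⟨ sh-assoc f (proj₁ w) (proj₁ v) γ ⟩
           sh (sh f (proj₁ w)) (proj₁ v) γ              ∎) ⟩
    ⟨ monomial m′ , sh (sh f (proj₁ w)) (proj₁ v) ⟩
      ≈⟨ trans (pair-monomial-∷ w (v ∷ m′)) (pair-monomial-∷ v m′) ⟨
    ⟨ monomial (w ∷ v ∷ m′) , f ⟩ ∎
  pair-monomial-↭ (Perm.trans p q) f = trans (pair-monomial-↭ p f) (pair-monomial-↭ q f)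

  monomialValue-++ : ∀ u m m′ → monomialValue u (m ++ m′) ≈ monomialValue u m * monomialValue u m′
  monomialValue-++ u []      m′ = sym (*-identityˡ _)
  monomialValue-++ u (v ∷ m) m′ = trans (*-congˡ (monomialValue-++ u m m′)) (sym (*-assoc _ _ _))

  monomialValue-↭ : ∀ u {m m′} → m ↭ m′ → monomialValue u m ≈ monomialValue u m′
  monomialValue-↭ u Perm.refl         = refl
  monomialValue-↭ u (prep v p)        = *-congˡ (monomialValue-↭ u p)
  monomialValue-↭ u (swap v w p)      = trans (*-congˡ (*-congˡ (monomialValue-↭ u p)))
    (solve 3 (λ x y z → x :* (y :* z) := y :* (x :* z)) refl _ _ _)
  monomialValue-↭ u (Perm.trans p q)  = trans (monomialValue-↭ u p) (monomialValue-↭ u q)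

  -- The quasi-shuffle adds sizes, so the product lies in degree `weight m`; phrased by functionals
  -- in order to serve the cutoff argument.
  monomial-homogeneous : ∀ m {f g} → (∀ α → size α ≡ weight m → f α ≈ g α) → ⟨ monomial m , f ⟩ ≈ ⟨ monomial m , g ⟩
  monomial-homogeneous [] f≈g = +-congʳ (*-congˡ (f≈g [] ≡.refl))
  monomial-homogeneous (v ∷ m) f≈g = trans (pair-monomial-∷ v m) (trans
    (monomial-homogeneous m (λ α α≡m → ∑-cong∈ (qsh (proj₁ v) α) (λ ε∈ →
      f≈g _ (≡.trans (qsh-size (proj₁ v) α ε∈) (≡.cong (size (proj₁ v) ℕ.+_) α≡m)))))
    (sym (pair-monomial-∷ v m)))

  ∑-filter : ∀ {a p} {X : Set a} {P : Pred X p} (P? : Decidable P) xs {f g : X → Carrier} →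
             (∀ x → P x → f x ≈ g x) → (∀ x → ¬ P x → g x ≈ 0#) → ∑ (filter P? xs) f ≈ ∑ xs g
  ∑-filter P? []       f≈g g≈0 = refl
  ∑-filter P? (x ∷ xs) f≈g g≈0 with P? x
  ... | yes px = +-cong (f≈g x px) (∑-filter P? xs f≈g g≈0)
  ... | no ¬px = trans (∑-filter P? xs f≈g g≈0) (sym (trans (+-congʳ (g≈0 x ¬px)) (+-identityˡ _)))

  weight≤? : ∀ n → Decidable {A = Carrier × List LynComp} (λ t → weight (proj₂ t) ℕ.≤ n)
  weight≤? n t = weight (proj₂ t) ℕ.≤? n

  truncate : ℕ → Poly → Poly
  truncate n = filter (weight≤? n)

  cutoff : ℕ → (Comp → Carrier) → Comp → Carrier
  cutoff n f α = if does (size α ℕ.≤? n) then f α else 0#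

  cutoff-≤ : ∀ n f {α} → size α ℕ.≤ n → cutoff n f α ≡ f α
  cutoff-≤ n f {α} α≤n = ≡.cong (if_then f α else 0#) (dec-true (size α ℕ.≤? n) α≤n)

  cutoff-≰ : ∀ n f {α} → ¬ (size α ℕ.≤ n) → cutoff n f α ≡ 0#
  cutoff-≰ n f {α} α≰n = ≡.cong (if_then f α else 0#) (dec-false (size α ℕ.≤? n) α≰n)

  -- Each monomial is homogeneous, so discarding the heavy ones amounts to testing in low degree
  -- only. An inhomogeneous expansion can thus be truncated without changing what it expands.
  pair-truncate : ∀ n p {f} → ⟨ evalM (truncate n p) , f ⟩ ≈ ⟨ evalM p , cutoff n f ⟩
  pair-truncate n p {f} = trans (pair-evalM (truncate n p)) (trans
    (∑-filter (weight≤? n) p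
      (λ t m≤n → *-congˡ (monomial-homogeneous (proj₂ t) (λ α α≡m →
        sym (reflexive (cutoff-≤ n f (≡.subst (ℕ._≤ n) (≡.sym α≡m) m≤n))))))
      (λ t m≰n → trans (*-congˡ (trans
        (monomial-homogeneous (proj₂ t) (λ α α≡m → reflexive (cutoff-≰ n f (m≰n ∘ ≡.subst (ℕ._≤ n) α≡m))))
        (pair-zero (monomial (proj₂ t)) (λ _ → refl)))) (zeroʳ _)))
    (sym (pair-evalM p)))

  weight-bound : ∀ (p : Poly) → ∃ λ n → ∀ {t} → t ∈ p → weight (proj₂ t) ℕ.≤ n
  weight-bound []      = 0 , λ ()
  weight-bound (t ∷ p) = let n , p≤n = weight-bound p in
    weight (proj₂ t) ℕ.+ n , λ { (here ≡.refl) → ℕₚ.m≤m+n _ n ; (there t∈) → ℕₚ.m≤n⇒m≤o+n _ (p≤n t∈) }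

  -- Word coordinates of a polynomial: orderings of one monomial share a word and different
  -- monomials do not, so the coefficients are those of the polynomial in commuting variables.
  wordCombination : Poly → Lin
  wordCombination = map (λ t → (proj₁ t , monomialWord (proj₂ t)))

  -- Evaluation is a linear functional of the word coordinates, hence respects a linear relation
  -- found among them; the same is needed of `evalM`.
  wordCombination-evalU : ∀ u p → ⟨ wordCombination p , monomialValue u ∘ wordMonomial ⟩ ≈ evalU u p
  wordCombination-evalU u p = trans (∑-map _ p) (trans
    (∑-cong p (λ t → *-congˡ (monomialValue-↭ u (wordMonomial-monomialWord (proj₂ t)))))
    (sym (evalU-∑ u p)))

  wordCombination-evalM : ∀ p f → ⟨ wordCombination p , (λ w → ⟨ monomial (wordMonomial w) , f ⟩) ⟩ ≈ ⟨ evalM p , f ⟩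
  wordCombination-evalM p f = trans (∑-map _ p) (trans
    (∑-cong p (λ t → *-congˡ (pair-monomial-↭ (wordMonomial-monomialWord (proj₂ t)) f)))
    (sym (pair-evalM p)))

  module _ (lyn : Comp → Poly) (lyn-expands : IsLyndonExpansion lyn) where

    -- The N compositions of size ≤ n have expansions spanned, after truncation to weight ≤ n, by at
    -- most N monomials; so p and these N expansions are linearly dependent as polynomials. Applying
    -- evalM to the dependency kills p and turns the expansions into the basis elements M_β, so every
    -- coefficient except that of p is zero, and p itself is zero.
    evalM-injective-0 : ∀ u p → (∀ f → ⟨ evalM p , f ⟩ ≈ 0#) → evalU u p ≈ 0#
    evalM-injective-0 u p evalM≈0 = *-cancel-0 k₀≉0 (begin
      k zero * evalU u p
        ≈⟨ +-identityʳ _ ⟨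
      k zero * evalU u p + 0#
        ≈⟨ +-congˡ (∑-zero (allFin N) (λ {i} _ → trans (*-congʳ (kₛ≈0 i)) (zeroˡ _))) ⟨
      k zero * evalU u p + ∑ (allFin N) (λ i → k (suc i) * evalU u (r (suc i)))
        ≈⟨ ∑-allFin-suc N ⟨
      ∑ (allFin (suc N)) (λ j → k j * evalU u (r j))
        ≈⟨ ∑-cong (allFin (suc N)) (λ j → *-congˡ (wordCombination-evalU u (r j))) ⟨
      ∑ (allFin (suc N)) (λ j → k j * ⟨ wordCombination (r j) , monomialValue u ∘ wordMonomial ⟩)
        ≈⟨ relation _ ⟩
      0# ∎)
      where
      n = proj₁ (weight-bound p)
      S = comps≤ n
      N = length S

      r : Fin (suc N) → Poly
      r zero    = p
      r (suc i) = truncate n (lyn (lookup S i))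

      r-weight : ∀ j {t} → t ∈ r j → weight (proj₂ t) ℕ.≤ n
      r-weight zero    t∈ = proj₂ (weight-bound p) t∈
      r-weight (suc i) t∈ = proj₂ (∈-filter⁻ (weight≤? n) {xs = lyn (lookup S i)} t∈)

      words⊆S : ∀ j {t} → t ∈ wordCombination (r j) → proj₂ t ∈ S
      words⊆S j t∈ with ∈-map⁻ _ t∈
      ... | t , t∈r , ≡.refl = ∈-comps≤⁺ _ (≡.subst (ℕ._≤ n) (≡.sym (size-monomialWord (proj₂ t))) (r-weight j t∈r))

      dependency = dependent (suc N) S (λ j → coeff (wordCombination (r j))) (ℕₚ.n<1+n N)
      k = proj₁ dependency

      relation : ∀ g → ∑ (allFin (suc N)) (λ j → k j * ⟨ wordCombination (r j) , g ⟩) ≈ 0#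
      relation g = begin
        ∑ (allFin (suc N)) (λ j → k j * ⟨ wordCombination (r j) , g ⟩)
          ≈⟨ ∑-cong (allFin (suc N)) (λ j → trans
               (*-congˡ (pair-expand (comps≤-! n) (wordCombination (r j)) (words⊆S j) g))
               (trans (sym (∑-*ˡ S (k j))) (∑-cong S (λ _ → sym (*-assoc _ _ _))))) ⟩
        ∑ (allFin (suc N)) (λ j → ∑ S (λ s → k j * coeff (wordCombination (r j)) s * g s))
          ≈⟨ ∑-swap (allFin (suc N)) S ⟩
        ∑ S (λ s → ∑ (allFin (suc N)) (λ j → k j * coeff (wordCombination (r j)) s * g s))
          ≈⟨ ∑-zero S (λ {s} s∈ → trans (∑-*ʳ (allFin (suc N)) (g s))
               (trans (*-congʳ (proj₂ (proj₂ dependency) s∈)) (zeroˡ _))) ⟩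
        0# ∎

      evalM-relation : ∀ f → ∑ (allFin (suc N)) (λ j → k j * ⟨ evalM (r j) , f ⟩) ≈ 0#
      evalM-relation f = trans
        (∑-cong (allFin (suc N)) (λ j → *-congˡ (sym (wordCombination-evalM (r j) f)))) (relation _)

      pair-r : ∀ i f → ⟨ evalM (r (suc i)) , f ⟩ ≈ f (lookup S i)
      pair-r i f = begin
        ⟨ evalM (truncate n (lyn (lookup S i))) , f ⟩ ≈⟨ pair-truncate n (lyn (lookup S i)) ⟩
        ⟨ evalM (lyn (lookup S i)) , cutoff n f ⟩     ≈⟨ ≃⇒pair (evalM (lyn (lookup S i))) (basis (lookup S i)) (lyn-expands (lookup S i)) (cutoff n f) ⟩
        ⟨ basis (lookup S i) , cutoff n f ⟩           ≈⟨ pair-basis (lookup S i) (cutoff n f) ⟩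
        cutoff n f (lookup S i)                       ≡⟨ cutoff-≤ n f (∈-comps≤⁻ n (∈-lookup i)) ⟩
        f (lookup S i)                                ∎

      kₛ≈0 : ∀ i → k (suc i) ≈ 0#
      kₛ≈0 i = begin
        k (suc i)
          ≈⟨ *-identityʳ _ ⟨
        k (suc i) * 1#
          ≡⟨ ≡.cong (k (suc i) *_) (δ-refl (lookup S i)) ⟨
        k (suc i) * f (lookup S i)
          ≈⟨ ∑-single (Uniqueₚ.allFin⁺ N) (∈-allFin i) (λ {j} _ j≢i → trans
               (*-congˡ (reflexive (δ-≢ (j≢i ∘ lookup-injective (comps≤-! n) j i)))) (zeroʳ _)) ⟨
        ∑ (allFin N) (λ j → k (suc j) * f (lookup S j))
          ≈⟨ ∑-cong (allFin N) (λ j → *-congˡ (pair-r j f)) ⟨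
        ∑ (allFin N) (λ j → k (suc j) * ⟨ evalM (r (suc j)) , f ⟩)
          ≈⟨ trans (+-congʳ (trans (*-congˡ (evalM≈0 f)) (zeroʳ _))) (+-identityˡ _) ⟨
        k zero * ⟨ evalM p , f ⟩ + ∑ (allFin N) (λ j → k (suc j) * ⟨ evalM (r (suc j)) , f ⟩)
          ≈⟨ ∑-allFin-suc N ⟨
        ∑ (allFin (suc N)) (λ j → k j * ⟨ evalM (r j) , f ⟩)
          ≈⟨ evalM-relation f ⟩
        0# ∎
        -- This functional isolates the coefficient at index `i`, because `S` lists its compositions
        -- without repetition.
        where f = δ (lookup S i)

      k₀≉0 : ¬ (k zero ≈ 0#)
      k₀≉0 with proj₁ (proj₂ dependency)
      ... | zero  , k≉0 = k≉0
      ... | suc i , k≉0 = contradiction (kₛ≈0 i) k≉0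

    evalM-injective : ∀ u p q → (∀ f → ⟨ evalM p , f ⟩ ≈ ⟨ evalM q , f ⟩) → evalU u p ≈ evalU u q
    evalM-injective u p q p~q = begin
      evalU u p                             ≈⟨ +-identityʳ _ ⟨
      evalU u p + 0#                        ≈⟨ +-congˡ (-‿inverseˡ _) ⟨
      evalU u p + (- evalU u q + evalU u q) ≈⟨ +-assoc _ _ _ ⟨
      evalU u p + - evalU u q + evalU u q   ≈⟨ +-congʳ (trans (+-cong (evalU-∑ u p) (-‿cong (evalU-∑ u q))) (sym (difference (monomialValue u)))) ⟩
      ∑ p-q (λ t → proj₁ t * monomialValue u (proj₂ t)) + evalU u q
        ≈⟨ +-congʳ (trans (sym (evalU-∑ u p-q)) (evalM-injective-0 u p-q evalM-p-q≈0)) ⟩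
      0# + evalU u q                        ≈⟨ +-identityˡ _ ⟩
      evalU u q                             ∎
      where
      p-q : Poly
      p-q = p ++ map (λ t → (- 1# * proj₁ t , proj₂ t)) q

      difference : ∀ (h : List LynComp → Carrier) → ∑ p-q (λ t → proj₁ t * h (proj₂ t)) ≈
                   ∑ p (λ t → proj₁ t * h (proj₂ t)) + - ∑ q (λ t → proj₁ t * h (proj₂ t))
      difference h = trans (∑-++ p _) (+-congˡ (trans (∑-map _ q) (trans
        (∑-cong q (λ _ → *-assoc _ _ _)) (trans (∑-*ˡ q (- 1#)) (-1*x≈-x _)))))

      evalM-p-q≈0 : ∀ f → ⟨ evalM p-q , f ⟩ ≈ 0#
      evalM-p-q≈0 f = begin
        ⟨ evalM p-q , f ⟩                      ≈⟨ pair-evalM p-q ⟩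
        ∑ p-q (λ t → proj₁ t * ⟨ monomial (proj₂ t) , f ⟩) ≈⟨ difference (λ m → ⟨ monomial m , f ⟩) ⟩
        _ + - _                                ≈⟨ +-cong (pair-evalM p) (-‿cong (pair-evalM q)) ⟨
        ⟨ evalM p , f ⟩ + - ⟨ evalM q , f ⟩    ≈⟨ +-congʳ (p~q f) ⟩
        ⟨ evalM q , f ⟩ + - ⟨ evalM q , f ⟩    ≈⟨ -‿inverseʳ _ ⟩
        0#                                     ∎

-- Characters and their values on Lyndon compositions.

module Characters {c ℓ : Level} (R : RealField c ℓ) where
  open RealField R hiding (zero)
  open QSym R
  open Pairing R
  open Bialgebra R
  open Freeness R
  open RingSolver commutativeSemiring using (solve; _:=_; _:+_; _:*_)
  open SetoidReasoning setoid

  IsCharacter : (Comp → Carrier) → Set _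
  IsCharacter χ = χ [] ≈ 1# × (∀ β γ → sh χ β γ ≈ χ β * χ γ)

  character-monomial : ∀ {χ} → IsCharacter χ → ∀ m → ⟨ monomial m , χ ⟩ ≈ monomialValue (χ ∘ proj₁) m
  character-monomial {χ} (χ1 , χ*) []      = trans (pair-basis [] χ) χ1
  character-monomial {χ} (χ1 , χ*) (v ∷ m) = begin
    ⟨ monomial (v ∷ m) , χ ⟩                    ≈⟨ pair-monomial-∷ v m ⟩
    ⟨ monomial m , sh χ (proj₁ v) ⟩             ≈⟨ pair-cong (monomial m) (χ* (proj₁ v)) ⟩
    ⟨ monomial m , (λ γ → χ (proj₁ v) * χ γ) ⟩  ≈⟨ pair-*ˡ (monomial m) (χ (proj₁ v)) ⟩
    χ (proj₁ v) * ⟨ monomial m , χ ⟩            ≈⟨ *-congˡ (character-monomial (χ1 , χ*) m) ⟩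
    monomialValue (χ ∘ proj₁) (v ∷ m)           ∎

  module _ (lyn : Comp → Poly) (lyn-expands : IsLyndonExpansion lyn) where

    pair-evalM-lyn : ∀ β f → ⟨ evalM (lyn β) , f ⟩ ≈ f β
    pair-evalM-lyn β f = trans (≃⇒pair (evalM (lyn β)) (basis β) (lyn-expands β) f) (pair-basis β f)

    -- A linear multiplicative functional commutes with polynomial expressions, so it may be applied
    -- inside the expansion of `M_β`.
    character-determined : ∀ {χ} → IsCharacter χ → ∀ β → χ β ≈ evalU (χ ∘ proj₁) (lyn β)
    character-determined {χ} χ-char β = begin
      χ β                        ≈⟨ pair-evalM-lyn β χ ⟨
      ⟨ evalM (lyn β) , χ ⟩      ≈⟨ pair-evalM (lyn β) ⟩
      ∑ (lyn β) (λ t → proj₁ t * ⟨ monomial (proj₂ t) , χ ⟩)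
                                 ≈⟨ ∑-cong (lyn β) (λ t → *-congˡ (character-monomial χ-char (proj₂ t))) ⟩
      ∑ (lyn β) (λ t → proj₁ t * monomialValue (χ ∘ proj₁) (proj₂ t))
                                 ≈⟨ evalU-∑ (χ ∘ proj₁) (lyn β) ⟨
      evalU (χ ∘ proj₁) (lyn β)  ∎

    -- Independence enters here: the product of `lyn β` and `lyn γ` and the sum of `lyn ε` over the
    -- quasi-shuffles are two polynomials with the same image `M_β M_γ`, hence have the same value.
    -- For the unit, `lyn []` is compared with the constant polynomial 1.
    evalU-lyn-character : ∀ u → IsCharacter (λ β → evalU u (lyn β))
    evalU-lyn-character u = ζ1 , ζ*
      where
      ζ : Comp → Carrier
      ζ β = evalU u (lyn β)

      ζ1 : ζ [] ≈ 1#
      ζ1 = trans (evalM-injective lyn lyn-expands u (lyn []) ((1# , []) ∷ []) λ f → begin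
             ⟨ evalM (lyn []) , f ⟩               ≈⟨ pair-evalM-lyn [] f ⟩
             f []                                 ≈⟨ pair-basis [] f ⟨
             ⟨ one , f ⟩                          ≈⟨ trans (+-identityʳ _) (*-identityˡ _) ⟨
             1# * ⟨ one , f ⟩ + 0#                ≈⟨ pair-evalM ((1# , []) ∷ []) {f} ⟨
             ⟨ evalM ((1# , []) ∷ []) , f ⟩       ∎)
           (trans (+-identityʳ _) (*-identityˡ _))

      ζ* : ∀ β γ → sh ζ β γ ≈ ζ β * ζ γ
      ζ* β γ = begin
        sh ζ β γ
          ≈⟨ sum-value ⟨
        evalU u summed
          ≈⟨ evalM-injective lyn lyn-expands u summed product same ⟩
        evalU u product
          ≈⟨ product-value ⟩
        ζ β * ζ γ ∎
        where
        summed : Poly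
        summed = concatMap lyn (qsh β γ)

        product : Poly
        product = concatMap (λ s → map (λ t → (proj₁ s * proj₁ t , proj₂ s ++ proj₂ t)) (lyn γ)) (lyn β)

        over-product : ∀ (h : List LynComp → Carrier) → ∑ product (λ t → proj₁ t * h (proj₂ t)) ≈
          ∑ (lyn β) (λ s → proj₁ s * ∑ (lyn γ) (λ t → proj₁ t * h (proj₂ s ++ proj₂ t)))
        over-product h = trans (∑-concatMap _ (lyn β)) (∑-cong (lyn β) (λ s → trans (∑-map _ (lyn γ))
          (trans (∑-cong (lyn γ) (λ _ → *-assoc _ _ _)) (∑-*ˡ (lyn γ) (proj₁ s)))))

        sum-value : evalU u summed ≈ sh ζ β γ
        sum-value = trans (evalU-∑ u summed) (trans (∑-concatMap lyn (qsh β γ))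
          (∑-cong (qsh β γ) (λ ε → sym (evalU-∑ u (lyn ε)))))

        product-value : evalU u product ≈ ζ β * ζ γ
        product-value = begin
          evalU u product
            ≈⟨ trans (evalU-∑ u product) (over-product (monomialValue u)) ⟩
          ∑ (lyn β) (λ s → proj₁ s * ∑ (lyn γ) (λ t → proj₁ t * monomialValue u (proj₂ s ++ proj₂ t)))
            ≈⟨ ∑-cong (lyn β) (λ s → trans
                 (*-congˡ (trans (∑-cong (lyn γ) (λ t → trans (*-congˡ (monomialValue-++ u (proj₂ s) (proj₂ t)))
                     (solve 3 (λ x y z → x :* (y :* z) := y :* (x :* z)) refl _ _ _)))
                   (trans (∑-*ˡ (lyn γ) (monomialValue u (proj₂ s))) (*-congˡ (sym (evalU-∑ u (lyn γ)))))))
                 (sym (*-assoc _ _ _))) ⟩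
          ∑ (lyn β) (λ s → proj₁ s * monomialValue u (proj₂ s) * ζ γ)
            ≈⟨ trans (∑-*ʳ (lyn β) (ζ γ)) (*-congʳ (sym (evalU-∑ u (lyn β)))) ⟩
          ζ β * ζ γ ∎

        same : ∀ f → ⟨ evalM summed , f ⟩ ≈ ⟨ evalM product , f ⟩
        same f = begin
          ⟨ evalM summed , f ⟩
            ≈⟨ trans (pair-evalM summed) (∑-concatMap lyn (qsh β γ)) ⟩
          ∑ (qsh β γ) (λ ε → ∑ (lyn ε) (λ t → proj₁ t * ⟨ monomial (proj₂ t) , f ⟩))
            ≈⟨ sh-cong β γ (λ ε → trans (sym (pair-evalM (lyn ε))) (pair-evalM-lyn ε f)) ⟩
          sh f β γ
            ≈⟨ trans (pair-evalM-lyn β (λ β′ → ⟨ evalM (lyn γ) , sh f β′ ⟩)) (pair-evalM-lyn γ (sh f β)) ⟨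
          ⟨ evalM (lyn β) , (λ β′ → ⟨ evalM (lyn γ) , sh f β′ ⟩) ⟩
            ≈⟨ pair-evalM (lyn β) ⟩
          ∑ (lyn β) (λ s → proj₁ s * ⟨ monomial (proj₂ s) , (λ β′ → ⟨ evalM (lyn γ) , sh f β′ ⟩) ⟩)
            ≈⟨ ∑-cong (lyn β) (λ s → *-congˡ (begin
                 ⟨ monomial (proj₂ s) , (λ β′ → ⟨ evalM (lyn γ) , sh f β′ ⟩) ⟩
                   ≈⟨ pair-cong (monomial (proj₂ s)) (λ β′ → pair-evalM (lyn γ)) ⟩
                 ⟨ monomial (proj₂ s) , (λ β′ → ∑ (lyn γ) (λ t → proj₁ t * ⟨ monomial (proj₂ t) , sh f β′ ⟩)) ⟩
                   ≈⟨ pair-∑ (monomial (proj₂ s)) (lyn γ) ⟩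
                 ∑ (lyn γ) (λ t → ⟨ monomial (proj₂ s) , (λ β′ → proj₁ t * ⟨ monomial (proj₂ t) , sh f β′ ⟩) ⟩)
                   ≈⟨ ∑-cong (lyn γ) (λ t → trans (pair-*ˡ (monomial (proj₂ s)) (proj₁ t))
                        (*-congˡ (sym (pair-monomial-++ (proj₂ s) (proj₂ t))))) ⟩
                 ∑ (lyn γ) (λ t → proj₁ t * ⟨ monomial (proj₂ s ++ proj₂ t) , f ⟩) ∎)) ⟩
          ∑ (lyn β) (λ s → proj₁ s * ∑ (lyn γ) (λ t → proj₁ t * ⟨ monomial (proj₂ s ++ proj₂ t) , f ⟩))
            ≈⟨ trans (pair-evalM product) (over-product (λ m → ⟨ monomial m , f ⟩)) ⟨
          ⟨ evalM product , f ⟩ ∎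

-- The coefficients `A` and the recursion of `Φ` by first blocks.

module Coefficients {c ℓ : Level} (R : RealField c ℓ) where
  open RealField R hiding (zero)
  open QSym R
  open Pairing R
  open Bialgebra R
  open SetoidReasoning setoid

  ≡ᵇ-∸ : ∀ b n x → b ℕ.≤ n → (b ℕ.+ x ℕ.≡ᵇ n) ≡ (x ℕ.≡ᵇ n ∸ b)
  ≡ᵇ-∸ zero    n       x _           = ≡.refl
  ≡ᵇ-∸ (suc b) (suc n) x (ℕ.s≤s b≤n) = ≡ᵇ-∸ b n x b≤n

  D-size-∷ : ∀ b β n {F : Comp → Comp → Carrier} → D (λ x y → if size x ℕ.≡ᵇ suc n then F x y else 0#) (b ∷ β) ≈
             D (λ x y → if b ℕ.+ size x ℕ.≡ᵇ n then F (b ∷ x) y else 0#) β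
  D-size-∷ b β n = trans (D-∷ _ b β) (+-identityˡ _)

  -- Parts are positive, so prefixes of different length have different sizes: the sum over cuts has
  -- at most one surviving term, the one that `takeExact` finds.
  D-takeExact : ∀ n β {F : Comp → Comp → Carrier} → D (λ x y → if size x ℕ.≡ᵇ n then F x y else 0#) β ≈
                maybe′ (uncurry F) 0# (takeExact n β)
  D-takeExact zero    []      = +-identityʳ _
  D-takeExact zero    (b ∷ β) = trans (D-∷ _ b β) (trans
    (+-congˡ (∑-zero (deconc β) (λ _ → refl))) (+-identityʳ _))
  D-takeExact (suc n) []      = +-identityʳ _
  D-takeExact (suc n) (b ∷ β) {F} with suc b ℕ.≤ᵇ suc n in b≤ᵇn
  ... | false = trans (D-size-∷ b β n {F}) (∑-zero (deconc β) (λ {p} _ →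
    reflexive (≡.cong (λ t → if t then F (b ∷ proj₁ p) (proj₂ p) else 0#) (too-large (proj₁ p)))))
    where
    too-large : ∀ x → (b ℕ.+ size x ℕ.≡ᵇ n) ≡ false
    too-large x = dec-false (b ℕ.+ size x ℕ.≟ n) λ { ≡.refl →
      contradiction (≡.trans (≡.sym b≤ᵇn) (dec-true (suc b ℕ.≤? suc n) (ℕ.s≤s (ℕₚ.m≤m+n b (size x))))) (λ ()) }
  ... | true  with takeExact (n ∸ b) β | trans
        (D-cong β (λ x y → reflexive (≡.cong (λ t → if t then F (b ∷ x) y else 0#)
          (≡ᵇ-∸ b n (size x) (ℕ.s≤s⁻¹ (ℕₚ.≤ᵇ⇒≤ (suc b) (suc n) (≡.subst T (≡.sym b≤ᵇn) _)))))))
        (D-takeExact (n ∸ b) β {λ x y → F (b ∷ x) y})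
  ...   | nothing | ih = trans (D-size-∷ b β n {F}) ih
  ...   | just _  | ih = trans (D-size-∷ b β n {F}) ih

  δ-∷ : ∀ a α n ε → δ (a ∷ α) (n ∷ ε) ≈ (if n ℕ.≡ᵇ a then 1# else 0#) * δ α ε
  δ-∷ a α n ε = if-∧ (n ℕ.≡ᵇ a) (ε =c α)

  module _ (lyn : Comp → Poly) (u : LynComp → Carrier) where

    ζ : Comp → Carrier
    ζ β = evalU u (lyn β)

    A-[] : ∀ β → A lyn u β [] ≈ δ [] β
    A-[] []      = refl
    A-[] (_ ∷ _) = refl

    -- Trades the search performed by `splitBy` for a sum over all cuts, a form that interacts with
    -- the coproduct. The coefficients of an arbitrary endomorphism will satisfy the same recursion.
    A-∷ : ∀ β a α → A lyn u β (a ∷ α) ≈ D (λ x y → if size x ℕ.≡ᵇ suc a then ζ x * A lyn u y α else 0#) β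
    A-∷ β a α = sym (trans (D-takeExact (suc a) β) taken)
      where
      taken : maybe′ (uncurry (λ x y → ζ x * A lyn u y α)) 0# (takeExact (suc a) β) ≈ A lyn u β (a ∷ α)
      taken with takeExact (suc a) β
      ... | nothing = refl
      ... | just (x , y) with splitBy α y
      ...   | nothing = zeroʳ _
      ...   | just _  = refl

    A-size : ∀ α β → size α ≢ size β → A lyn u β α ≈ 0#
    A-size []      []      ≢ = contradiction ≡.refl ≢
    A-size []      (_ ∷ _) ≢ = refl
    A-size (a ∷ α) β       ≢ = trans (A-∷ β a α) (trans (D-cong∈ {G = λ _ _ → 0#} β vanish) (∑-zero (deconc β) (λ _ → refl)))
      where
      vanish : ∀ x y → x ++ y ≡ β → (if size x ℕ.≡ᵇ suc a then ζ x * A lyn u y α else 0#) ≈ 0#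
      vanish x y ≡.refl with size x ℕ.≡ᵇ suc a in x≡a
      ... | false = refl
      ... | true  = trans (*-congˡ (A-size α y (λ α≡y → ≢ (≡.sym (≡.trans (size-++ x y)
        (≡.cong₂ ℕ._+_ (ℕₚ.≡ᵇ⇒≡ (size x) (suc a) (≡.subst T (≡.sym x≡a) _)) (≡.sym α≡y))))))) (zeroʳ _)

    pair-Φ : ∀ β f → ⟨ Φ lyn u β , f ⟩ ≈ ∑ (comps (size β)) (λ α → A lyn u β α * f α)
    pair-Φ β f = ∑-map _ (comps (size β))

    -- `Φ` lists only the compositions of `size β`; outside that list `A` vanishes because block
    -- sizes add up.
    coeff-Φ : ∀ β α → coeff (Φ lyn u β) α ≈ A lyn u β α
    coeff-Φ β α with size α ℕ.≟ size β
    ... | yes eq = trans (coeff-pair (Φ lyn u β) α) (trans (pair-Φ β (δ α)) (trans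
      (∑-single (comps-! (size β)) (≡.subst (λ n → α ∈ comps n) eq (∈-comps⁺ α))
        (λ _ ≢α → trans (*-congˡ (reflexive (δ-≢ ≢α))) (zeroʳ _)))
      (trans (*-congˡ (reflexive (δ-refl α))) (*-identityʳ _))))
    ... | no neq = trans (coeff-pair (Φ lyn u β) α) (trans (pair-Φ β (δ α)) (trans
      (∑-zero (comps (size β)) (λ {γ} γ∈ → trans (*-congˡ (reflexive
        (δ-≢ {α} {γ} (λ { ≡.refl → neq (∈-comps⁻ (size β) γ∈) })))) (zeroʳ _)))
      (sym (A-size α β neq))))

    pair-Φ-[] : ∀ f → ⟨ Φ lyn u [] , f ⟩ ≈ f []
    pair-Φ-[] = pair-basis []

    -- The first block of β contributes one factor ζ and one letter; the other blocks are handled by Φ.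
    pair-Φ-∷ : ∀ b β f → ⟨ Φ lyn u (b ∷ β) , f ⟩ ≈
               D (λ x y → ζ (b ∷ x) * ⟨ Φ lyn u y , f ∘ (b ℕ.+ size x ∷_) ⟩) β
    pair-Φ-∷ b β f = trans (≃⇒pair (Φ lyn u (b ∷ β)) byBlocks same f) (pair-byBlocks f)
      where
      -- The entry `b + size x` encodes a part of size `suc b + size x`, the size of the block
      -- `b ∷ x`. Equality with `Φ` is checked on coefficients, where it is the recursion `A-∷`.
      byBlocks : Lin
      byBlocks = concatMap (λ p → map (λ t → (ζ (b ∷ proj₁ p) * proj₁ t , b ℕ.+ size (proj₁ p) ∷ proj₂ t))
                   (Φ lyn u (proj₂ p))) (deconc β)

      pair-byBlocks : ∀ f → ⟨ byBlocks , f ⟩ ≈ D (λ x y → ζ (b ∷ x) * ⟨ Φ lyn u y , f ∘ (b ℕ.+ size x ∷_) ⟩) β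
      pair-byBlocks f = trans (∑-concatMap _ (deconc β)) (∑-cong (deconc β) (λ p →
        trans (∑-map _ (Φ lyn u (proj₂ p))) (trans (∑-cong (Φ lyn u (proj₂ p)) (λ _ → *-assoc _ _ _))
          (∑-*ˡ (Φ lyn u (proj₂ p)) (ζ (b ∷ proj₁ p))))))

      byBlocks-A : ∀ α → ⟨ byBlocks , δ α ⟩ ≈ A lyn u (b ∷ β) α
      byBlocks-A [] = trans (pair-byBlocks (δ [])) (∑-zero (deconc β) (λ {p} _ →
        trans (*-congˡ (pair-zero (Φ lyn u (proj₂ p)) (λ _ → refl))) (zeroʳ _)))
      byBlocks-A (a ∷ α) = trans (pair-byBlocks (δ (a ∷ α))) (trans
        (D-cong β (λ x y → trans (*-congˡ (begin
            ⟨ Φ lyn u y , δ (a ∷ α) ∘ (b ℕ.+ size x ∷_) ⟩ ≈⟨ pair-cong (Φ lyn u y) (δ-∷ a α (b ℕ.+ size x)) ⟩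
            ⟨ Φ lyn u y , (λ ε → (if b ℕ.+ size x ℕ.≡ᵇ a then 1# else 0#) * δ α ε) ⟩ ≈⟨ pair-*ˡ (Φ lyn u y) _ ⟩
            (if b ℕ.+ size x ℕ.≡ᵇ a then 1# else 0#) * ⟨ Φ lyn u y , δ α ⟩
              ≈⟨ *-congˡ (trans (sym (coeff-pair (Φ lyn u y) α)) (coeff-Φ y α)) ⟩
            (if b ℕ.+ size x ℕ.≡ᵇ a then 1# else 0#) * A lyn u y α ∎))
          (select (b ℕ.+ size x ℕ.≡ᵇ a))))
        (sym (trans (A-∷ (b ∷ β) a α) (trans (D-∷ _ b β) (+-identityˡ _)))))
        where
        select : ∀ t {p q} → p * ((if t then 1# else 0#) * q) ≈ (if t then p * q else 0#)
        select true  = *-congˡ (*-identityˡ _)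
        select false = trans (*-congˡ (zeroˡ _)) (zeroʳ _)

      same : Φ lyn u (b ∷ β) ≃ byBlocks
      same α = trans (coeff-Φ (b ∷ β) α) (sym (trans (coeff-pair byBlocks α) (byBlocks-A α)))

length-suffix : ∀ (x : Comp) {y α} → x ++ y ≡ α → length y ℕ.≤ length α
length-suffix x {y} ≡.refl = ≡.subst (length y ℕ.≤_) (≡.sym (length-++ x)) (ℕₚ.m≤n+m _ (length x))

-- Every assignment of values gives a Hopf endomorphism.

module Endomorphism {c ℓ : Level} (R : RealField c ℓ) (lyn : Comp → QSym.Poly R)
         (lyn-expands : QSym.IsLyndonExpansion R lyn) (u : LynComp → RealField.Carrier R) where
  open RealField R hiding (zero)
  open QSym R
  open Pairing R
  open Bialgebra R
  open Characters R
  open Coefficients R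
  open RingSolver commutativeSemiring using (solve; _:=_; _:+_; _:*_)
  open SetoidReasoning setoid

  private
    φ : Comp → Lin
    φ = Φ lyn u

    z : Comp → Carrier
    z = ζ lyn u

    z* : ∀ β γ → sh z β γ ≈ z β * z γ
    z* = proj₂ (evalU-lyn-character lyn lyn-expands u)

    block : (Comp → Carrier) → ℕ → Comp → Comp → Carrier
    block f b x y = z (b ∷ x) * ⟨ φ y , f ∘ (b ℕ.+ size x ∷_) ⟩

    φ-∷ : ∀ b β f → ⟨ φ (b ∷ β) , f ⟩ ≈ D (block f b) β
    φ-∷ = pair-Φ-∷ lyn u

    φ-[] : ∀ f → ⟨ φ [] , f ⟩ ≈ f []
    φ-[] = pair-Φ-[] lyn u

  -- The image is cut before its first letter or after it. In the second case, choosing the first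
  -- block and then a cut of the rest is, by coassociativity, choosing a cut of `β` and then the
  -- first block of its left part. The bound `n` drives the recursion, whose argument is an
  -- arbitrary suffix.
  Φ-comult : ∀ n β → length β ℕ.≤ n → ∀ F → ⟨ φ β , D F ⟩ ≈ D (λ x y → ⟨ φ x , (λ α → ⟨ φ y , F α ⟩) ⟩) β
  Φ-comult n [] _ F = begin
    ⟨ φ [] , D F ⟩                              ≈⟨ trans (φ-[] (D F)) (D-[] F) ⟩
    F [] []                                     ≈⟨ trans (φ-[] (λ α → ⟨ φ [] , F α ⟩)) (φ-[] (F [])) ⟨
    ⟨ φ [] , (λ α → ⟨ φ [] , F α ⟩) ⟩           ≈⟨ D-[] (λ x y → ⟨ φ x , (λ α → ⟨ φ y , F α ⟩) ⟩) ⟨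
    D (λ x y → ⟨ φ x , (λ α → ⟨ φ y , F α ⟩) ⟩) [] ∎
  Φ-comult (suc n) (b ∷ β) (ℕ.s≤s β≤n) F = begin
    ⟨ φ (b ∷ β) , D F ⟩
      ≈⟨ φ-∷ b β (D F) ⟩
    D (block (D F) b) β
      ≈⟨ D-cong∈ β (λ x y xy≡β → let m = b ℕ.+ size x in trans
           (*-congˡ (trans (pair-cong (φ y) (D-∷ F m)) (trans (pair-+ (φ y))
             (+-congˡ (Φ-comult n y (ℕₚ.≤-trans (length-suffix x xy≡β) β≤n) (λ α → F (m ∷ α)))))))
           (distribˡ _ _ _)) ⟩
    D (λ x y → block (F []) b x y + z (b ∷ x) * D (λ y₁ y₂ → ⟨ φ y₁ , (λ α → ⟨ φ y₂ , F (b ℕ.+ size x ∷ α) ⟩) ⟩) y) β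
      ≈⟨ trans (D-+ β) (+-cong (sym (φ-∷ b β (F []))) (trans
           (D-cong β (λ x y → sym (∑-*ˡ (deconc y) (z (b ∷ x)))))
           (sym (D-coassoc (λ x y₁ y₂ → z (b ∷ x) * ⟨ φ y₁ , (λ α → ⟨ φ y₂ , F (b ℕ.+ size x ∷ α) ⟩) ⟩) β)))) ⟩
    ⟨ φ (b ∷ β) , F [] ⟩ + D (λ x y → D (block (λ α → ⟨ φ y , F α ⟩) b) x) β
      ≈⟨ +-cong (sym (φ-[] (λ α → ⟨ φ (b ∷ β) , F α ⟩))) (D-cong β (λ x y → sym (φ-∷ b x (λ α → ⟨ φ y , F α ⟩)))) ⟩
    ⟨ φ [] , (λ α → ⟨ φ (b ∷ β) , F α ⟩) ⟩ + D (λ x y → ⟨ φ (b ∷ x) , (λ α → ⟨ φ y , F α ⟩) ⟩) β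
      ≈⟨ D-∷ _ b β ⟨
    D (λ x y → ⟨ φ x , (λ α → ⟨ φ y , F α ⟩) ⟩) (b ∷ β) ∎

  private
    -- The value of `f` on the product of the images of `M_β` and `M_γ`.
    φ⊗φ : (Comp → Carrier) → Comp → Comp → Carrier
    φ⊗φ f β γ = ⟨ φ β , (λ α → ⟨ φ γ , sh f α ⟩) ⟩

    -- A first block must be nonempty; giving the empty one the value zero turns the recursion for
    -- `Φ` into a sum over all cuts, to which `D-sh` applies.
    blocks : (Comp → Carrier) → Comp → Comp → Carrier
    blocks f []      y = 0#
    blocks f (b ∷ x) y = block f b x y

    φ-blocks : ∀ f b β → ⟨ φ (b ∷ β) , f ⟩ ≈ D (blocks f) (b ∷ β)
    φ-blocks f b β = trans (φ-∷ b β f) (sym (trans (D-∷ (blocks f) b β) (+-identityˡ _)))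

    -- Once the size of the block is known, the block itself matters only through `z`.
    blocks-size : ∀ f x {ε k} → size ε ≡ suc k → blocks f ε x ≈ z ε * ⟨ φ x , f ∘ (k ∷_) ⟩
    blocks-size f x {a ∷ ε} ≡.refl = refl

    -- Both letters merge, or one of the two comes first: the three terms of the quasi-shuffle.
    φ⊗φ-∷ : ∀ f b β c γ → φ⊗φ f (b ∷ β) (c ∷ γ) ≈
      D (λ x y → z (b ∷ x) * φ⊗φ (f ∘ (b ℕ.+ size x ∷_)) y (c ∷ γ)) β
      + (D (λ x′ y′ → z (c ∷ x′) * φ⊗φ (f ∘ (c ℕ.+ size x′ ∷_)) (b ∷ β) y′) γ
      + D (λ x y → D (λ x′ y′ → z (b ∷ x) * (z (c ∷ x′) *
          φ⊗φ (f ∘ (suc (b ℕ.+ size x ℕ.+ (c ℕ.+ size x′)) ∷_)) y y′)) γ) β)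
    φ⊗φ-∷ f b β c γ = begin
      φ⊗φ f (b ∷ β) (c ∷ γ)
        ≈⟨ φ-∷ b β _ ⟩
      D (λ x y → z (b ∷ x) * ⟨ φ y , (λ α → ⟨ φ (c ∷ γ) , sh f (b ℕ.+ size x ∷ α) ⟩) ⟩) β
        ≈⟨ D-cong β (λ x y → trans (*-congˡ (trans
             (pair-cong (φ y) (expand (b ℕ.+ size x)))
             (trans (pair-+ (φ y)) (+-congˡ (trans (pair-+ (φ y)) (+-cong (pair-blocks y) (pair-blocks y)))))))
             (trans (distribˡ _ _ _) (+-congˡ (distribˡ _ _ _)))) ⟩
      D (λ x y → z (b ∷ x) * φ⊗φ (f ∘ (b ℕ.+ size x ∷_)) y (c ∷ γ)
          + (z (b ∷ x) * D (λ x′ y′ → z (c ∷ x′) * ⟨ φ y , (λ α → ⟨ φ y′ , sh (f ∘ (c ℕ.+ size x′ ∷_)) (b ℕ.+ size x ∷ α) ⟩) ⟩) γ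
          + z (b ∷ x) * D (λ x′ y′ → z (c ∷ x′) * φ⊗φ (f ∘ (suc (b ℕ.+ size x ℕ.+ (c ℕ.+ size x′)) ∷_)) y y′) γ)) β
        ≈⟨ trans (D-+ β) (+-congˡ (trans (D-+ β) (+-cong second (D-cong β (λ x y → sym (∑-*ˡ (deconc γ) (z (b ∷ x)))))))) ⟩
      _ ∎
      where
      expand : ∀ m α → ⟨ φ (c ∷ γ) , sh f (m ∷ α) ⟩ ≈
        ⟨ φ (c ∷ γ) , sh (f ∘ (m ∷_)) α ⟩
        + (D (λ x′ y′ → z (c ∷ x′) * ⟨ φ y′ , sh (f ∘ (c ℕ.+ size x′ ∷_)) (m ∷ α) ⟩) γ
        + D (λ x′ y′ → z (c ∷ x′) * ⟨ φ y′ , sh (f ∘ (suc (m ℕ.+ (c ℕ.+ size x′)) ∷_)) α ⟩) γ)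
      expand m α = begin
        ⟨ φ (c ∷ γ) , sh f (m ∷ α) ⟩
          ≈⟨ φ-∷ c γ _ ⟩
        D (λ x′ y′ → z (c ∷ x′) * ⟨ φ y′ , (λ α′ → sh f (m ∷ α) (c ℕ.+ size x′ ∷ α′)) ⟩) γ
          ≈⟨ D-cong γ (λ x′ y′ → trans (*-congˡ (trans (pair-cong (φ y′) (sh-∷ f m α (c ℕ.+ size x′)))
               (trans (pair-+ (φ y′)) (+-congˡ (pair-+ (φ y′))))))
               (trans (distribˡ _ _ _) (+-congˡ (distribˡ _ _ _)))) ⟩
        D (λ x′ y′ → block (sh (f ∘ (m ∷_)) α) c x′ y′
            + (z (c ∷ x′) * ⟨ φ y′ , sh (f ∘ (c ℕ.+ size x′ ∷_)) (m ∷ α) ⟩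
            + z (c ∷ x′) * ⟨ φ y′ , sh (f ∘ (suc (m ℕ.+ (c ℕ.+ size x′)) ∷_)) α ⟩)) γ
          ≈⟨ trans (D-+ γ) (+-cong (sym (φ-∷ c γ (sh (f ∘ (m ∷_)) α))) (D-+ γ)) ⟩
        _ ∎

      pair-blocks : ∀ y {F : Comp → Comp → Comp → Carrier} →
        ⟨ φ y , (λ α → D (λ x′ y′ → z (c ∷ x′) * ⟨ φ y′ , F x′ α ⟩) γ) ⟩ ≈
        D (λ x′ y′ → z (c ∷ x′) * ⟨ φ y , (λ α → ⟨ φ y′ , F x′ α ⟩) ⟩) γ
      pair-blocks y = trans (pair-∑ (φ y) (deconc γ)) (∑-cong (deconc γ) (λ p → pair-*ˡ (φ y) (z (c ∷ proj₁ p))))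

      -- Here the right image supplies the first letter. Interchanging the sums lets the one over
      -- the first blocks of `b ∷ β` fold back into an intact left image.
      second :
        D (λ x y → z (b ∷ x) * D (λ x′ y′ → z (c ∷ x′) *
          ⟨ φ y , (λ α → ⟨ φ y′ , sh (f ∘ (c ℕ.+ size x′ ∷_)) (b ℕ.+ size x ∷ α) ⟩) ⟩) γ) β ≈
        D (λ x′ y′ → z (c ∷ x′) * φ⊗φ (f ∘ (c ℕ.+ size x′ ∷_)) (b ∷ β) y′) γ
      second = trans
        (D-cong β (λ x y → trans (sym (∑-*ˡ (deconc γ) (z (b ∷ x))))
          (D-cong γ (λ x′ y′ → solve 3 (λ p q r → p :* (q :* r) := q :* (p :* r)) refl _ _ _))))
        (trans (D-swap β γ) (D-cong γ (λ x′ y′ → trans (∑-*ˡ (deconc β) (z (c ∷ x′)))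
          (*-congˡ (sym (φ-∷ b β (λ α → ⟨ φ y′ , sh (f ∘ (c ℕ.+ size x′ ∷_)) α ⟩)))))))

  -- By `D-sh`, splitting off the first block of a quasi-shuffle means cutting both factors and
  -- shuffling the pieces separately. A block drawn from one factor gives a letter of that image; a
  -- block drawn from both gives a merged letter.
  Φ-mult : ∀ n β γ → length β ℕ.+ length γ ℕ.≤ n → ∀ f → sh (λ ε → ⟨ φ ε , f ⟩) β γ ≈ φ⊗φ f β γ
  Φ-mult n [] γ _ f = begin
    sh (λ ε → ⟨ φ ε , f ⟩) [] γ   ≈⟨ sh-[]ˡ (λ ε → ⟨ φ ε , f ⟩) γ ⟩
    ⟨ φ γ , f ⟩                   ≈⟨ pair-cong (φ γ) (sh-[]ˡ f) ⟨
    ⟨ φ γ , sh f [] ⟩             ≈⟨ φ-[] (λ α → ⟨ φ γ , sh f α ⟩) ⟨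
    φ⊗φ f [] γ                    ∎
  Φ-mult n β@(_ ∷ _) [] _ f = begin
    sh (λ ε → ⟨ φ ε , f ⟩) β []   ≈⟨ sh-[]ʳ (λ ε → ⟨ φ ε , f ⟩) β ⟩
    ⟨ φ β , f ⟩                   ≈⟨ pair-cong (φ β) (λ α → trans (φ-[] (sh f α)) (sh-[]ʳ f α)) ⟨
    φ⊗φ f β []                    ∎
  Φ-mult (suc n) s@(b ∷ β) t@(c ∷ γ) (ℕ.s≤s s+t≤n) f = begin
    sh (λ ε → ⟨ φ ε , f ⟩) s t
      ≈⟨ trans (sh-∷ _ b β c γ) (trans
           (+-cong (sh-cong β t (φ-blocks f b)) (+-cong (sh-cong s γ (φ-blocks f c)) (sh-cong β γ (φ-blocks f (suc (b ℕ.+ c))))))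
           (sym (sh-∷ (D (blocks f)) b β c γ))) ⟩
    sh (D (blocks f)) s t
      ≈⟨ D-sh (blocks f) s t ⟩
    D (λ β₁ β₂ → D (sh² (blocks f) β₁ β₂) t) s
      ≈⟨ trans (D-∷ _ b β) (+-cong (D-∷ (sh² (blocks f) [] s) c γ)
           (trans (D-cong β (λ x y → D-∷ (sh² (blocks f) (b ∷ x) y) c γ)) (D-+ β))) ⟩
    (sh² (blocks f) [] s [] t + D (λ x′ y′ → sh² (blocks f) [] s (c ∷ x′) y′) γ)
      + (D (λ x y → sh² (blocks f) (b ∷ x) y [] t) β
        + D (λ x y → D (λ x′ y′ → sh² (blocks f) (b ∷ x) y (c ∷ x′) y′) γ) β)
      -- With both left pieces empty, the first block is empty and contributes zero; the other three
      -- cases are the terms of `φ⊗φ-∷`.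
      ≈⟨ +-cong (+-cong (trans (+-identityʳ _) (∑-zero (qsh s t) (λ _ → refl))) (D-cong∈ γ second))
           (+-cong (D-cong∈ β first) (D-cong∈ β (λ x y xy≡β → D-cong∈ γ (λ x′ y′ x′y′≡γ → both x y xy≡β x′ y′ x′y′≡γ)))) ⟩
    (0# + D (λ x′ y′ → z (c ∷ x′) * φ⊗φ (f ∘ (c ℕ.+ size x′ ∷_)) s y′) γ)
      + (D (λ x y → z (b ∷ x) * φ⊗φ (f ∘ (b ℕ.+ size x ∷_)) y t) β
        + D (λ x y → D (λ x′ y′ → z (b ∷ x) * (z (c ∷ x′) *
            φ⊗φ (f ∘ (suc (b ℕ.+ size x ℕ.+ (c ℕ.+ size x′)) ∷_)) y y′)) γ) β)
      ≈⟨ trans (+-congʳ (+-identityˡ _)) (solve 3 (λ p q r → p :+ (q :+ r) := q :+ (p :+ r)) refl _ _ _) ⟩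
    _
      ≈⟨ φ⊗φ-∷ f b β c γ ⟨
    φ⊗φ f s t ∎
    where
    first : ∀ x y → x ++ y ≡ β → sh² (blocks f) (b ∷ x) y [] t ≈ z (b ∷ x) * φ⊗φ (f ∘ (b ℕ.+ size x ∷_)) y t
    first x y xy≡β = trans (+-identityʳ _) (trans (∑-*ˡ (qsh y t) (z (b ∷ x))) (*-congˡ (Φ-mult n y t
      (ℕₚ.≤-trans (ℕₚ.+-monoˡ-≤ (suc (length γ)) (length-suffix x xy≡β)) s+t≤n) _)))

    second : ∀ x′ y′ → x′ ++ y′ ≡ γ → sh² (blocks f) [] s (c ∷ x′) y′ ≈ z (c ∷ x′) * φ⊗φ (f ∘ (c ℕ.+ size x′ ∷_)) s y′
    second x′ y′ x′y′≡γ = trans (+-identityʳ _) (trans (∑-*ˡ (qsh s y′) (z (c ∷ x′))) (*-congˡ (Φ-mult n s y′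
      (ℕₚ.≤-trans (ℕₚ.+-monoʳ-≤ (suc (length β)) (length-suffix x′ x′y′≡γ))
        (ℕₚ.≤-trans (ℕₚ.≤-reflexive (≡.sym (ℕₚ.+-suc (length β) (length γ)))) s+t≤n)) _)))

    both : ∀ x y → x ++ y ≡ β → ∀ x′ y′ → x′ ++ y′ ≡ γ → sh² (blocks f) (b ∷ x) y (c ∷ x′) y′ ≈
           z (b ∷ x) * (z (c ∷ x′) * φ⊗φ (f ∘ (suc (b ℕ.+ size x ℕ.+ (c ℕ.+ size x′)) ∷_)) y y′)
    both x y xy≡β x′ y′ x′y′≡γ = begin
      sh (λ ε → sh (blocks f ε) y y′) (b ∷ x) (c ∷ x′)
        ≈⟨ ∑-cong∈ (qsh (b ∷ x) (c ∷ x′)) (λ {ε} ε∈ → trans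
             (sh-cong y y′ (λ y″ → blocks-size f y″ {ε} (≡.trans (qsh-size (b ∷ x) (c ∷ x′) ε∈) (ℕₚ.+-suc (suc (b ℕ.+ size x)) (c ℕ.+ size x′)))))
             (∑-*ˡ (qsh y y′) (z ε))) ⟩
      sh (λ ε → z ε * sh (λ y″ → ⟨ φ y″ , f ∘ (suc (b ℕ.+ size x ℕ.+ (c ℕ.+ size x′)) ∷_) ⟩) y y′) (b ∷ x) (c ∷ x′)
        -- The second factor no longer depends on `ε`, so the sum over the quasi-shuffles of the two
        -- blocks reaches `z` alone, which is multiplicative.
        ≈⟨ trans (∑-*ʳ (qsh (b ∷ x) (c ∷ x′)) _) (trans (*-congʳ (z* (b ∷ x) (c ∷ x′))) (*-assoc _ _ _)) ⟩
      z (b ∷ x) * (z (c ∷ x′) * sh (λ y″ → ⟨ φ y″ , f ∘ (suc (b ℕ.+ size x ℕ.+ (c ℕ.+ size x′)) ∷_) ⟩) y y′)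
        ≈⟨ *-congˡ (*-congˡ (Φ-mult n y y′ (ℕₚ.≤-trans
             (ℕₚ.+-mono-≤ (length-suffix x xy≡β) (ℕₚ.m≤n⇒m≤1+n (length-suffix x′ x′y′≡γ))) s+t≤n) _)) ⟩
      z (b ∷ x) * (z (c ∷ x′) * φ⊗φ (f ∘ (suc (b ℕ.+ size x ℕ.+ (c ℕ.+ size x′)) ∷_)) y y′) ∎

  Φ-isHopfEndo : IsHopfEndo φ
  Φ-isHopfEndo = record
    { graded  = λ β α α≢β → trans (coeff-Φ lyn u β α) (A-size lyn u α β α≢β)
    ; unit    = pair⇒≃ (apply φ one) one (λ f → begin
        ⟨ apply φ one , f ⟩           ≈⟨ pair-apply φ one {f} ⟩
        ⟨ one , (λ β → ⟨ φ β , f ⟩) ⟩ ≈⟨ trans (pair-basis [] (λ β → ⟨ φ β , f ⟩)) (φ-[] f) ⟩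
        f []                          ≈⟨ pair-basis [] f ⟨
        ⟨ one , f ⟩                   ∎)
    ; mult    = λ x y → pair⇒≃ (apply φ (mul x y)) (mul (apply φ x) (apply φ y)) (λ f → begin
        ⟨ apply φ (mul x y) , f ⟩
          ≈⟨ trans (pair-apply φ (mul x y)) (pair-mul x y) ⟩
        ⟨ x , (λ β → ⟨ y , sh (λ ε → ⟨ φ ε , f ⟩) β ⟩) ⟩
          ≈⟨ pair-cong x (λ β → trans (pair-cong y (λ γ → Φ-mult (length β ℕ.+ length γ) β γ ℕₚ.≤-refl f))
               (pair-swap y (φ β) {λ γ α → ⟨ φ γ , sh f α ⟩})) ⟩
        ⟨ x , (λ β → ⟨ φ β , (λ α → ⟨ y , (λ γ → ⟨ φ γ , sh f α ⟩) ⟩) ⟩) ⟩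
          ≈⟨ trans (pair-apply φ x) (pair-cong x (λ β → pair-cong (φ β) (λ α → pair-apply φ y))) ⟨
        ⟨ apply φ x , (λ α → ⟨ apply φ y , sh f α ⟩) ⟩
          ≈⟨ pair-mul (apply φ x) (apply φ y) ⟨
        ⟨ mul (apply φ x) (apply φ y) , f ⟩ ∎)
    ; counitˡ = λ x → begin
        counit (apply φ x)                   ≈⟨ coeff-pair (apply φ x) [] ⟩
        ⟨ apply φ x , δ [] ⟩                 ≈⟨ pair-apply φ x ⟩
        ⟨ x , (λ β → ⟨ φ β , δ [] ⟩) ⟩       ≈⟨ pair-cong x (λ β → trans (sym (coeff-pair (φ β) [])) (trans (coeff-Φ lyn u β []) (A-[] lyn u β))) ⟩
        ⟨ x , δ [] ⟩                         ≈⟨ coeff-pair x [] ⟨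
        counit x                             ∎
    ; comult  = λ x γ ε → let F = λ γ′ ε′ → δ γ γ′ * δ ε ε′ in begin
        coeff₂ (Δ (apply φ x)) γ ε
          ≈⟨ trans (coeff₂-pair (Δ (apply φ x)) γ ε) (pair-Δ (apply φ x)) ⟩
        ⟨ apply φ x , D F ⟩
          ≈⟨ pair-apply φ x ⟩
        ⟨ x , (λ β → ⟨ φ β , D F ⟩) ⟩
          ≈⟨ pair-cong x (λ β → Φ-comult (length β) β ℕₚ.≤-refl F) ⟩
        ⟨ x , D (λ y y′ → ⟨ φ y , (λ α → ⟨ φ y′ , F α ⟩) ⟩) ⟩
          ≈⟨ trans (pair-apply₂ φ (Δ x)) (pair-Δ x) ⟨
        ⟪ apply₂ φ (Δ x) , F ⟫
          ≈⟨ coeff₂-pair (apply₂ φ (Δ x)) γ ε ⟨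
        coeff₂ (apply₂ φ (Δ x)) γ ε ∎
    }

-- Every Hopf endomorphism arises from an assignment of values.

module Classification {c ℓ : Level} (R : RealField c ℓ) (lyn : Comp → QSym.Poly R)
         (lyn-expands : QSym.IsLyndonExpansion R lyn)
         (img : Comp → QSym.Lin R) (img-endo : QSym.IsHopfEndo R img) where
  open RealField R hiding (zero)
  open QSym R
  open Pairing R
  open Bialgebra R
  open Characters R
  open Coefficients R
  open IsHopfEndo img-endo
  open SetoidReasoning setoid

  -- Evaluation at x₁ = 1, x₂ = x₃ = ⋯ = 0.
  ev : Comp → Carrier
  ev []      = 1#
  ev (_ ∷ α) = δ [] α

  -- Multiplicativity of the counit: quasi-shuffling with a nonempty word never gives the empty one.
  sh-δ[] : ∀ β γ → sh (δ []) β γ ≈ δ [] β * δ [] γ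
  sh-δ[] []      γ       = trans (+-identityʳ _) (sym (*-identityˡ _))
  sh-δ[] (b ∷ β) []      = trans (+-identityʳ _) (sym (*-identityʳ _))
  sh-δ[] (b ∷ β) (c ∷ γ) = trans (sh-∷ (δ []) b β c γ) (trans
    (+-cong (∑-zero (qsh β (c ∷ γ)) (λ _ → refl))
      (+-cong (∑-zero (qsh (b ∷ β) γ) (λ _ → refl)) (∑-zero (qsh β γ) (λ _ → refl))))
    (trans (+-identityˡ _) (trans (+-identityˡ _) (sym (zeroˡ _)))))

  ev-isCharacter : IsCharacter ev
  ev-isCharacter = refl , ev*
    where
    ev* : ∀ β γ → sh ev β γ ≈ ev β * ev γ
    ev* []      γ       = trans (+-identityʳ _) (sym (*-identityˡ _))
    ev* (b ∷ β) []      = trans (+-identityʳ _) (sym (*-identityʳ _))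
    -- Only the term that merges `b` and `c` can produce a composition with a single part.
    ev* (b ∷ β) (c ∷ γ) = trans (sh-∷ ev b β c γ) (trans
      (+-cong (trans (sh-δ[] β (c ∷ γ)) (zeroʳ _)) (+-cong (trans (sh-δ[] (b ∷ β) γ) (zeroˡ _)) (sh-δ[] β γ)))
      (trans (+-identityˡ _) (+-identityˡ _)))

  χ : Comp → Carrier
  χ β = ⟨ img β , ev ⟩

  χ-isCharacter : IsCharacter χ
  χ-isCharacter = χ1 , χ*
    where
    χ1 : χ [] ≈ 1#
    χ1 = begin
      χ []                        ≈⟨ trans (pair-apply img one) (pair-basis [] χ) ⟨
      ⟨ apply img one , ev ⟩      ≈⟨ ≃⇒pair (apply img one) one unit ev ⟩
      ⟨ one , ev ⟩                ≈⟨ pair-basis [] ev ⟩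
      1#                          ∎

    apply-basis : ∀ β f → ⟨ apply img (basis β) , f ⟩ ≈ ⟨ img β , f ⟩
    apply-basis β f = trans (pair-apply img (basis β)) (pair-basis β (λ β → ⟨ img β , f ⟩))

    χ* : ∀ β γ → sh χ β γ ≈ χ β * χ γ
    χ* β γ = begin
      sh χ β γ
        ≈⟨ trans (pair-basis β (λ β → ⟨ basis γ , sh χ β ⟩)) (pair-basis γ (sh χ β)) ⟨
      ⟨ basis β , (λ β → ⟨ basis γ , sh χ β ⟩) ⟩
        ≈⟨ trans (pair-apply img (mul (basis β) (basis γ))) (pair-mul (basis β) (basis γ)) ⟨
      ⟨ apply img (mul (basis β) (basis γ)) , ev ⟩
        ≈⟨ ≃⇒pair (apply img (mul (basis β) (basis γ))) (mul (apply img (basis β)) (apply img (basis γ))) (mult (basis β) (basis γ)) ev ⟩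
      ⟨ mul (apply img (basis β)) (apply img (basis γ)) , ev ⟩
        ≈⟨ trans (pair-mul (apply img (basis β)) (apply img (basis γ)))
             (trans (apply-basis β _) (pair-cong (img β) (λ α → apply-basis γ (sh ev α)))) ⟩
      ⟨ img β , (λ α → ⟨ img γ , sh ev α ⟩) ⟩
        ≈⟨ pair-cong (img β) (λ α → trans (pair-cong (img γ) (proj₂ ev-isCharacter α)) (pair-*ˡ (img γ) (ev α))) ⟩
      ⟨ img β , (λ α → ev α * χ γ) ⟩
        ≈⟨ pair-*ʳ (img β) (χ γ) ⟩
      χ β * χ γ ∎

  u : LynComp → Carrier
  u = χ ∘ proj₁

  -- By gradedness `img β` lives in degree `size β`. If this is `suc a`, then `ev` restricted to
  -- that degree is the coefficient of the one-part composition, and the character `χ` takes over;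
  -- otherwise the coefficient is zero.
  coeff-img-[_] : ∀ a β → coeff (img β) (a ∷ []) ≈ (if size β ℕ.≡ᵇ suc a then ζ lyn u β else 0#)
  coeff-img-[ a ] β with size β ℕ.≡ᵇ suc a in size≡
  ... | false = graded β (a ∷ []) (λ a≡ → contradiction
    (≡.trans (≡.sym size≡) (dec-true (size β ℕ.≟ suc a) (≡.trans (≡.sym a≡) (≡.cong suc (ℕₚ.+-identityʳ a))))) (λ ()))
  ... | true = trans (coeff-pair (img β) (a ∷ [])) (trans (pair-agree (img β) same)
      (character-determined lyn lyn-expands χ-isCharacter β))
    where
    size-β : size β ≡ suc a
    size-β = ℕₚ.≡ᵇ⇒≡ (size β) (suc a) (≡.subst T (≡.sym size≡) _)

    same : ∀ α → coeff (img β) α ≈ 0# ⊎ δ (a ∷ []) α ≈ ev α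
    same α with size α ℕ.≟ size β
    ... | no α≢β = inj₁ (graded β α α≢β)
    same []          | yes α≡β = contradiction (≡.trans α≡β size-β) (λ ())
    same (b ∷ [])    | yes α≡β with ≡.trans (≡.sym (ℕₚ.+-identityʳ b)) (ℕₚ.suc-injective (≡.trans α≡β size-β))
    ...   | ≡.refl = inj₂ (reflexive (δ-refl (b ∷ [])))
    same (b ∷ b′ ∷ α) | yes _  = inj₂ (reflexive (δ-≢ {a ∷ []} {b ∷ b′ ∷ α} (λ ())))

  -- The pair of `a ∷ []` and `α` is a deconcatenation of `a ∷ α` alone, and once. A coefficient
  -- with several parts can thus be read off from the coproduct.
  D-δ : ∀ a α γ → D (λ x y → δ (a ∷ []) x * δ α y) γ ≈ δ (a ∷ α) γ
  D-δ a α []      = trans (+-identityʳ _) (zeroˡ _)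
  D-δ a α (n ∷ γ) = begin
    D (λ x y → δ (a ∷ []) x * δ α y) (n ∷ γ)
      ≈⟨ trans (D-∷ _ n γ) (trans (+-congʳ (zeroˡ _)) (+-identityˡ _)) ⟩
    D (λ x y → δ (a ∷ []) (n ∷ x) * δ α y) γ
      ≈⟨ trans (D-cong γ (λ x y → trans (*-congʳ (δ-∷ a [] n x)) (*-assoc _ _ _))) (∑-*ˡ (deconc γ) _) ⟩
    (if n ℕ.≡ᵇ a then 1# else 0#) * D (λ x y → δ [] x * δ α y) γ
      ≈⟨ *-congˡ (counit-D γ) ⟩
    (if n ℕ.≡ᵇ a then 1# else 0#) * δ α γ
      ≈⟨ δ-∷ a α n γ ⟨
    δ (a ∷ α) (n ∷ γ) ∎
    where
    counit-D : ∀ γ → D (λ x y → δ [] x * δ α y) γ ≈ δ α γ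
    counit-D []      = trans (+-identityʳ _) (*-identityˡ _)
    counit-D (m ∷ γ) = trans (D-∷ _ m γ) (trans
      (+-cong (*-identityˡ _) (∑-zero (deconc γ) (λ _ → zeroˡ _))) (+-identityʳ _))

  -- Induction on `α`: comultiplicativity splits its first part off, leaving a one-part coefficient
  -- times a coefficient for the remaining parts, which is the recursion `A-∷`. The counit settles
  -- the empty composition.
  coeff-img : ∀ α β → coeff (img β) α ≈ A lyn u β α
  coeff-img [] β = begin
    coeff (img β) []           ≈⟨ trans (coeff-pair (img β) []) (sym (pair-basis β (λ β → ⟨ img β , δ [] ⟩))) ⟩
    ⟨ basis β , (λ β → ⟨ img β , δ [] ⟩) ⟩ ≈⟨ pair-apply img (basis β) ⟨
    ⟨ apply img (basis β) , δ [] ⟩ ≈⟨ coeff-pair (apply img (basis β)) [] ⟨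
    counit (apply img (basis β)) ≈⟨ counitˡ (basis β) ⟩
    counit (basis β)           ≈⟨ trans (coeff-pair (basis β) []) (pair-basis β (δ [])) ⟩
    δ [] β                     ≈⟨ A-[] lyn u β ⟨
    A lyn u β []               ∎
  coeff-img (a ∷ α) β = begin
    coeff (img β) (a ∷ α)
      ≈⟨ trans (coeff-pair (img β) (a ∷ α)) (pair-cong (img β) (λ γ → sym (D-δ a α γ))) ⟩
    ⟨ img β , D F ⟩
      ≈⟨ trans (pair-Δ (apply img (basis β))) (trans (pair-apply img (basis β)) (pair-basis β (λ β → ⟨ img β , D F ⟩))) ⟨
    ⟪ Δ (apply img (basis β)) , F ⟫
      ≈⟨ coeff₂-pair (Δ (apply img (basis β))) (a ∷ []) α ⟨
    coeff₂ (Δ (apply img (basis β))) (a ∷ []) α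
      ≈⟨ comult (basis β) (a ∷ []) α ⟩
    coeff₂ (apply₂ img (Δ (basis β))) (a ∷ []) α
      ≈⟨ trans (coeff₂-pair (apply₂ img (Δ (basis β))) (a ∷ []) α) (pair-apply₂ img (Δ (basis β))) ⟩
    ⟪ Δ (basis β) , (λ x y → ⟨ img x , (λ γ → ⟨ img y , F γ ⟩) ⟩) ⟫
      ≈⟨ trans (pair-Δ (basis β)) (pair-basis β (D (λ x y → ⟨ img x , (λ γ → ⟨ img y , F γ ⟩) ⟩))) ⟩
    D (λ x y → ⟨ img x , (λ γ → ⟨ img y , F γ ⟩) ⟩) β
      ≈⟨ D-cong β (λ x y → begin
           ⟨ img x , (λ γ → ⟨ img y , F γ ⟩) ⟩
             ≈⟨ trans (pair-cong (img x) (λ γ → pair-*ˡ (img y) (δ (a ∷ []) γ))) (pair-*ʳ (img x) _) ⟩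
           ⟨ img x , δ (a ∷ []) ⟩ * ⟨ img y , δ α ⟩
             ≈⟨ *-cong (coeff-pair (img x) (a ∷ [])) (coeff-pair (img y) α) ⟨
           coeff (img x) (a ∷ []) * coeff (img y) α
             ≈⟨ *-cong (coeff-img-[ a ] x) (coeff-img α y) ⟩
           (if size x ℕ.≡ᵇ suc a then ζ lyn u x else 0#) * A lyn u y α
             ≈⟨ if-*ʳ (size x ℕ.≡ᵇ suc a) ⟩
           (if size x ℕ.≡ᵇ suc a then ζ lyn u x * A lyn u y α else 0#) ∎) ⟩
    D (λ x y → if size x ℕ.≡ᵇ suc a then ζ lyn u x * A lyn u y α else 0#) β
      ≈⟨ A-∷ lyn u β a α ⟨
    A lyn u β (a ∷ α) ∎
    where
    F : Comp → Comp → Carrier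
    F x y = δ (a ∷ []) x * δ α y

    if-*ʳ : ∀ t {p q} → (if t then p else 0#) * q ≈ (if t then p * q else 0#)
    if-*ʳ true  = refl
    if-*ʳ false = zeroˡ _

  coeff-img-Φ : ∀ β α → coeff (img β) α ≈ coeff (Φ lyn u β) α
  coeff-img-Φ β α = trans (coeff-img α β) (sym (coeff-Φ lyn u β α))

theorem5p1 : ∀ {c ℓ : Level} (R : RealField c ℓ) (lyn : Comp → QSym.Poly R) →
    QSym.IsLyndonExpansion R lyn →
    ((u : LynComp → RealField.Carrier R) → QSym.IsHopfEndo R (QSym.Φ R lyn u))
    × ((img : Comp → QSym.Lin R) → QSym.IsHopfEndo R img →
    Σ (LynComp → RealField.Carrier R) (λ u →
    ∀ β α → RealField._≈_ R (QSym.coeff R (img β) α) (QSym.coeff R (QSym.Φ R lyn u β) α)))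
theorem5p1 R lyn lyn-expands =
    Endomorphism.Φ-isHopfEndo R lyn lyn-expands
  , λ img img-endo → Classification.u R lyn lyn-expands img img-endo
                   , Classification.coeff-img-Φ R lyn lyn-expands img img-endo
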